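{- Let $m \geq 1$, $h \geq 2$ and $g \geq 2$ be integers. Each of the three functions $t \mapsto b_m[g](t)$, $t \mapsto b_m^-[g](t)$ and $t \mapsto b_{m,h}(t)$ (defined for positive integers $t$) is a quasipolynomial in $t$ of degree $m-1$ with leading coefficient $\frac{1}{(m-1)!}$.
   Context: A ruler of length $t$ with $m+1$ markings is a sequence of integers $0=x_0<x_1<\cdots<x_{m-1}<x_m=t$; the $x_i$ are its markings. The ruler is a $B_2[g]$-set if each positive integer admits at most $g$ representations as a sum of two markings. Here representations are unordered, and the two markings may be equal: a representation of $n$ is a pair of indices $i\le j$ with $x_i+x_j=n$. The ruler is a $B_2^-[g]$-set if each positive integer admits at most $g$ representations as a difference of two markings, a representation of $n$ being a pair $i<j$ with $x_j-x_i=n$. The ruler is a $B_h$-set if each positive integer admits at most one representation as a sum of $h$ markings. Equivalently, for every pair of distinct sequences $0\le r_1\le\cdots\le r_h\le m$ and $0\le s_1\le\cdots\le s_h\le m$ one has $x_{r_1}+\cdots+x_{r_h}\ne x_{s_1}+\cdots+x_{s_h}$. For a positive integer $t$, $b_m[g](t)$, $b_m^-[g](t)$ and $b_{m,h}(t)$ denote the numbers of rulers of length $t$ with $m+1$ markings that are respectively $B_2[g]$-sets, $B_2^-[g]$-sets and $B_h$-sets. A quasipolynomial of degree $d$ is a function of the form $t\mapsto c_d(t)t^d+\cdots+c_1(t)t+c_0(t)$, where each $c_i$ is a periodic function on the integers and $c_d$ is not identically zero. Saying that its leading coefficient is $c$ means that $c_d$ is constant, equal to $c$. -}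

module Defs where

open import Data.Fin.Base as Fin using (Fin; toℕ; fromℕ)
import Data.Fin.Properties as Fin
open import Data.Integer.Base as ℤ using (ℤ; +_)
open import Data.List.Base using (List; []; _∷_; length; filter; upTo; allFin; cartesianProduct; cartesianProductWith)
open import Data.List.Membership.Propositional using (_∈_)
open import Data.List.Membership.Propositional.Properties
  using (∈-filter⁺; ∈-filter⁻; ∈-upTo⁺; ∈-cartesianProductWith⁺)
open import Data.List.Relation.Unary.All as All using (All)
open import Data.List.Relation.Unary.AllPairs as AllPairs using ()
open import Data.List.Relation.Unary.Any using (here)
open import Data.List.Relation.Unary.Unique.Propositional using (Unique)
import Data.List.Relation.Unary.Unique.Propositional.Properties as Unique
open import Data.Nat.Base using (ℕ; zero; suc; _+_; _∸_; _≤_; _<_; z≤n; s≤s)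
open import Data.Nat.Properties using (_≟_; _≤?_; _<?_; ≤-trans; ≤-reflexive; <⇒≤)
open import Data.Product.Base using (Σ; ∃; _×_; _,_; uncurry)
open import Data.Rational.Base as ℚ using (ℚ; 0ℚ)
open import Data.Rational.Properties using (+-0-commutativeMonoid)
open import Data.Vec.Base as Vec using (Vec; []; _∷_; head; last; lookup)
open import Data.Vec.Properties using (∷-injective)
import Data.Vec.Relation.Unary.All as VecAll
open import Data.Vec.Relation.Unary.Linked using (Linked; [-]; _∷_; linked?)
open import Relation.Binary.PropositionalEquality using (_≡_; _≢_; refl; sym; subst)
open import Relation.Nullary using (Dec)
open import Relation.Nullary.Decidable using (_×-dec_; _→-dec_; map′)
open import Relation.Unary using (Decidable)

open import Algebra.Properties.CommutativeMonoid.Sum +-0-commutativeMonoid using (sum⁺-syntax)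

vectors : ∀ {A : Set} → List A → (k : ℕ) → List (Vec A k)
vectors xs zero    = [] ∷ []
vectors xs (suc k) = cartesianProductWith _∷_ xs (vectors xs k)

-- A ruler starts at 0 and increases, so its markings can be taken in ℕ.
IsRuler : (m t : ℕ) → Vec ℕ (suc m) → Set
IsRuler m t x = head x ≡ 0 × Linked _<_ x × last x ≡ t

isRuler? : ∀ m t → Decidable (IsRuler m t)
isRuler? m t x = (head x ≟ 0) ×-dec linked? _<?_ x ×-dec (last x ≟ t)

rulers : (m t : ℕ) → List (Vec ℕ (suc m))
rulers m t = filter (isRuler? m t) (vectors (upTo (suc t)) (suc m))

-- The next two results say that `rulers m t` lists every ruler exactly
-- once, so that filtering it and taking the length counts rulers.
rulers-complete : ∀ {m t x} → IsRuler m t x → x ∈ rulers m t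
rulers-complete {m} {t} r@(_ , inc , end) =
  ∈-filter⁺ (isRuler? m t)
    (∈-vectors (VecAll.map (λ p → ∈-upTo⁺ (s≤s (≤-trans p (≤-reflexive end)))) (≤last inc))) r
  where
  ∈-vectors : ∀ {A : Set} {xs : List A} {k} {v : Vec A k} → VecAll.All (_∈ xs) v → v ∈ vectors xs k
  ∈-vectors VecAll.[]       = here refl
  ∈-vectors (p VecAll.∷ ps) = ∈-cartesianProductWith⁺ _∷_ p (∈-vectors ps)

  ≤last : ∀ {k} {v : Vec ℕ (suc k)} → Linked _<_ v → VecAll.All (_≤ last v) v
  ≤last [-] = ≤-reflexive refl VecAll.∷ VecAll.[]
  ≤last {v = _ ∷ _ ∷ _} (a<b ∷ l) with ≤last l
  ... | b≤ VecAll.∷ rest = ≤-trans (<⇒≤ a<b) b≤ VecAll.∷ b≤ VecAll.∷ rest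

rulers-unique : ∀ m t → Unique (rulers m t)
rulers-unique m t = Unique.filter⁺ (isRuler? m t) (vectors-unique (suc m))
  where
  vectors-unique : ∀ k → Unique (vectors (upTo (suc t)) k)
  vectors-unique zero    = All.[] AllPairs.∷ AllPairs.[]
  vectors-unique (suc k) =
    Unique.cartesianProductWith⁺ _∷_ ∷-injective (Unique.upTo⁺ (suc t)) (vectors-unique k)

-- `rs` lists (without repetition) the candidate representations, and
-- `val r` is the integer that the candidate `r` represents.
#reps : {R : Set} → List R → (R → ℕ) → ℕ → ℕ
#reps rs val n = length (filter (λ r → val r ≟ n) rs)

AtMost : ℕ → {R : Set} → List R → (R → ℕ) → Set
AtMost g rs val = ∀ n → 0 < n → #reps rs val n ≤ g

-- It suffices to test those n that are represented at all.
atMost? : ∀ g {R : Set} (rs : List R) (val : R → ℕ) → Dec (AtMost g rs val)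
atMost? g rs val =
  map′ to (λ h → All.tabulate (λ {r} _ → h (val r)))
    (All.all? (λ r → (0 <? val r) →-dec (#reps rs val (val r) ≤? g)) rs)
  where
  to : All (λ r → 0 < val r → #reps rs val (val r) ≤ g) rs → AtMost g rs val
  to all n n>0 with filter (λ r → val r ≟ n) rs in eq
  ... | []    = z≤n
  ... | r ∷ _ with ∈-filter⁻ (λ r → val r ≟ n) {xs = rs} (subst (r ∈_) (sym eq) (here refl))
  ...   | r∈rs , refl = subst (λ l → length l ≤ g) eq (All.lookup all r∈rs n>0)

pairs≤ : (m : ℕ) → List (Fin (suc m) × Fin (suc m))
pairs≤ m = filter (uncurry Fin._≤?_) (cartesianProduct (allFin (suc m)) (allFin (suc m)))

pairs< : (m : ℕ) → List (Fin (suc m) × Fin (suc m))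
pairs< m = filter (uncurry Fin._<?_) (cartesianProduct (allFin (suc m)) (allFin (suc m)))

sequences≤ : (h m : ℕ) → List (Vec (Fin (suc m)) h)
sequences≤ h m = filter (linked? Fin._≤?_) (vectors (allFin (suc m)) h)

pairSum : ∀ {m} → Vec ℕ (suc m) → Fin (suc m) × Fin (suc m) → ℕ
pairSum x (i , j) = lookup x i + lookup x j

-- On a ruler i < j gives x i < x j, so the truncated subtraction is exact.
pairDiff : ∀ {m} → Vec ℕ (suc m) → Fin (suc m) × Fin (suc m) → ℕ
pairDiff x (i , j) = lookup x j ∸ lookup x i

sequenceSum : ∀ {h m} → Vec ℕ (suc m) → Vec (Fin (suc m)) h → ℕ
sequenceSum x r = Vec.sum (Vec.map (lookup x) r)

IsB₂[_] : ℕ → ∀ {m} → Vec ℕ (suc m) → Set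
IsB₂[ g ] {m} x = AtMost g (pairs≤ m) (pairSum x)

IsB₂⁻[_] : ℕ → ∀ {m} → Vec ℕ (suc m) → Set
IsB₂⁻[ g ] {m} x = AtMost g (pairs< m) (pairDiff x)

IsB : (h : ℕ) → ∀ {m} → Vec ℕ (suc m) → Set
IsB h {m} x = AtMost 1 (sequences≤ h m) (sequenceSum x)

isB₂[_]? : ∀ g {m} → Decidable (IsB₂[ g ] {m})
isB₂[ g ]? {m} x = atMost? g (pairs≤ m) (pairSum x)

isB₂⁻[_]? : ∀ g {m} → Decidable (IsB₂⁻[ g ] {m})
isB₂⁻[ g ]? {m} x = atMost? g (pairs< m) (pairDiff x)

isB? : ∀ h {m} → Decidable (IsB h {m})
isB? h {m} x = atMost? 1 (sequences≤ h m) (sequenceSum x)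

b[_] : (g m t : ℕ) → ℕ
b[ g ] m t = length (filter isB₂[ g ]? (rulers m t))

b⁻[_] : (g m t : ℕ) → ℕ
b⁻[ g ] m t = length (filter isB₂⁻[ g ]? (rulers m t))

bₕ : (h m t : ℕ) → ℕ
bₕ h m t = length (filter (isB? h) (rulers m t))

Periodic : (ℤ → ℚ) → Set
Periodic c = ∃ λ (p : ℕ) → 0 < p × (∀ t → c (t ℤ.+ + p) ≡ c t)

record Quasipolynomial (d : ℕ) : Set where
  field
    coeff    : Fin (suc d) → ℤ → ℚ
    periodic : ∀ i → Periodic (coeff i)
    leading≢0 : ∃ λ t → coeff (fromℕ d) t ≢ 0ℚ

  eval : ℤ → ℚ
  eval t = ∑[ i ≤ d ] (coeff i t ℚ.* ((t ℤ.^ toℕ i) ℚ./ 1))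

open Quasipolynomial public

-- For a counting function f, of which only the values at positive
-- arguments matter.
IsQuasipolynomial : (f : ℕ → ℕ) (degree : ℕ) (leading : ℚ) → Set
IsQuasipolynomial f d c = Σ (Quasipolynomial d) λ q →
  (∀ t → 0 < t → (+ f t) ℚ./ 1 ≡ eval q (+ t)) × (∀ t → coeff q (fromℕ d) t ≡ c)

{-# OPTIONS --safe #-}

-- The rulers of length t are the points of weight t (weight = last marking) of an open
-- simplicial cone {Σ nᵢ vᵢ : nᵢ ≥ 1}, the coefficients being the gaps of the ruler.  Whether a
-- ruler belongs to one of the three classes depends only on which of finitely many linear
-- forms (differences of two represented values) vanish on it.  An open cone splits, according
-- to n_u > n_v, n_u < n_v or n_u = n_v, into the cones in which the generators u, v are replaced
-- by u, u+v or by u+v, v or by u+v.  Repeating this makes every form of constant sign on every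
-- cone; then membership is constant on each cone, and the points of weight t of a cone with
-- generators v₁, …, v_k are counted by a function annihilated by the composition of the
-- difference operators with steps weight(v₁), …, weight(v_k), that is, by a quasi-polynomial of
-- degree < k valid for all t > 0.  Unimodularity of the splittings keeps every form from
-- vanishing identically on a cone of full dimension m, so the rulers outside the class lie on
-- cones of dimension < m and do not affect the coefficient of t^(m-1), which is that of the
-- number of all rulers.
module Submission where

open import Data.Fin.Base as Fin using (Fin; zero; suc; toℕ; fromℕ)
import Data.Fin.Properties as Fin
open import Data.Integer.Base as ℤ using (ℤ; +_; -[1+_]; +≤+; 0ℤ)
import Data.Integer.DivMod as ℤ
import Data.Integer.Properties as ℤ
import Data.Integer.Solver as ℤ
open import Data.List.Base using (List; []; _∷_; _++_; length; map; filter; upTo; applyUpTo; allFin; cartesianProduct; cartesianProductWith)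
open import Data.List.Membership.Propositional using (_∈_; find)
open import Data.List.Membership.Propositional.Properties
  using (∈-∃++; ∈-filter⁺; ∈-filter⁻; ∈-map⁺; ∈-map⁻; ∈-upTo⁺; ∈-cartesianProductWith⁺; ∈-cartesianProduct⁺; ∈-cartesianProduct⁻)
open import Data.List.Membership.Propositional.Properties.WithK using (unique∧set⇒bag)
open import Data.List.Properties using (++-identityʳ; length-map; map-upTo; filter-accept; filter-reject)
open import Data.List.Relation.Binary.BagAndSetEquality using (∼bag⇒↭)
open import Data.List.Relation.Binary.Permutation.Propositional as ↭ using (_↭_; ↭-sym)
import Data.List.Relation.Binary.Permutation.Propositional.Properties as ↭
open import Data.List.Relation.Unary.All as All using (All; []; _∷_)
import Data.List.Relation.Unary.All.Properties as All
open import Data.List.Relation.Unary.AllPairs using ([]; _∷_)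
open import Data.List.Relation.Unary.Any as Any using (Any; here; there)
open import Data.List.Relation.Unary.Unique.Propositional using (Unique)
import Data.List.Relation.Unary.Unique.Propositional.Properties as Unique
open import Data.Nat.Base as ℕ using (ℕ; zero; suc; z≤n; s≤s; _!; _<_; _≤_; _∸_)
import Data.Nat.DivMod as ℕ
import Data.Nat.ListAction as ℕ
import Data.Nat.ListAction.Properties as ℕ
import Data.Nat.Properties as ℕ
open import Data.Nat.Properties using (_!≢0)
import Data.Nat.Solver as ℕ
open import Data.Product.Base using (∃; _×_; _,_; proj₁; proj₂; uncurry)
open import Data.Product.Properties using () renaming (≡-dec to ×-≡-dec)
open import Data.Rational.Base using (ℚ; 0ℚ; 1ℚ; _/_; _+_; _*_; _-_; -_; toℚᵘ)
open import Data.Rational.Properties as ℚ using (+-0-commutativeMonoid; toℚᵘ-injective; toℚᵘ-fromℚᵘ; toℚᵘ-homo-+; toℚᵘ-homo-*)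
open import Data.Rational.Solver using (module +-*-Solver)
import Data.Rational.Unnormalised.Base as ℚᵘ
import Data.Rational.Unnormalised.Properties as ℚᵘ
open import Data.Sum.Base using (_⊎_; inj₁; inj₂)
open import Data.Vec.Base as Vec using (Vec; []; _∷_; head; last; lookup; replicate; zipWith)
open import Data.Vec.Properties using (zipWith-assoc; zipWith-comm; ∷-injective; lookup-zipWith; lookup-replicate) renaming (≡-dec to Vec-≡-dec)
import Data.Vec.Relation.Unary.All as VecAll
open import Data.Vec.Relation.Unary.Linked as Linked using (Linked; [-]; _∷_; linked?)
import Data.Vec.Relation.Unary.Linked.Properties as Linked
open import Function.Base using (_∘_; id)
open import Function.Bundles using (mk⇔)
open import Relation.Binary.Definitions using (DecidableEquality)
open import Relation.Binary.PropositionalEquality hiding ([_])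
open import Relation.Nullary using (Dec; yes; no; contradiction; ¬?)
open import Relation.Nullary.Decidable using (decidable-stable)
open import Relation.Unary using (Decidable)
open import Defs

open import Algebra.Properties.CommutativeMonoid.Sum +-0-commutativeMonoid
  using (sum-cong-≗; sum-init-last; sum-syntax)
open ≡-Reasoning

-- The embedding of the integers into the rationals.

κ : ℤ → ℚ
κ z = z / 1

κ-cong-≃ : ∀ z → toℚᵘ (κ z) ℚᵘ.≃ ℚᵘ.mkℚᵘ z 0
κ-cong-≃ z = toℚᵘ-fromℚᵘ (ℚᵘ.mkℚᵘ z 0)

κ-+ : ∀ a b → κ (a ℤ.+ b) ≡ κ a + κ b
κ-+ a b = toℚᵘ-injective (ℚᵘ.≃-trans (κ-cong-≃ (a ℤ.+ b)) (ℚᵘ.≃-sym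
  (ℚᵘ.≃-trans (toℚᵘ-homo-+ (κ a) (κ b)) (ℚᵘ.≃-trans (ℚᵘ.+-cong (κ-cong-≃ a) (κ-cong-≃ b))
    (ℚᵘ.*≡* (cong (ℤ._* + 1) (cong₂ ℤ._+_ (ℤ.*-identityʳ a) (ℤ.*-identityʳ b))))))))

κ-* : ∀ a b → κ (a ℤ.* b) ≡ κ a * κ b
κ-* a b = toℚᵘ-injective (ℚᵘ.≃-trans (κ-cong-≃ (a ℤ.* b)) (ℚᵘ.≃-sym
  (ℚᵘ.≃-trans (toℚᵘ-homo-* (κ a) (κ b)) (ℚᵘ.≃-trans (ℚᵘ.*-cong (κ-cong-≃ a) (κ-cong-≃ b))
    (ℚᵘ.*≡* refl)))))

-- Finite differences

Δ : ℕ → (ℕ → ℚ) → ℕ → ℚ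
Δ L f t = f (t ℕ.+ L) - f t

Δ^ : ℕ → ℕ → (ℕ → ℚ) → ℕ → ℚ
Δ^ L zero    f = f
Δ^ L (suc k) f = Δ^ L k (Δ L f)

infix 4 _≗⁺_

-- Agreement at positive arguments only: the cone without generators has a point of weight 0, so the
-- counting functions can deviate at 0. Shifts only increase arguments and therefore preserve this
-- relation.
_≗⁺_ : (f g : ℕ → ℚ) → Set
f ≗⁺ g = ∀ n → f (suc n) ≡ g (suc n)

Δ^-cong : ∀ L k {f g} → f ≗⁺ g → Δ^ L k f ≗⁺ Δ^ L k g
Δ^-cong L zero    f≗g = f≗g
Δ^-cong L (suc k) f≗g = Δ^-cong L k (λ n → cong₂ _-_ (f≗g (n ℕ.+ L)) (f≗g n))

Δ^-+ : ∀ L k f g → Δ^ L k (λ t → f t + g t) ≗⁺ λ t → Δ^ L k f t + Δ^ L k g t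
Δ^-+ L zero    f g n = refl
Δ^-+ L (suc k) f g n = trans
  (Δ^-cong L k (λ n → interchange (f (suc n ℕ.+ L)) (g (suc n ℕ.+ L)) (f (suc n)) (g (suc n))) n)
  (Δ^-+ L k (Δ L f) (Δ L g) n)
  where
  open +-*-Solver
  interchange : ∀ a b c d → (a + b) - (c + d) ≡ (a - c) + (b - d)
  interchange = solve 4 (λ a b c d → (a :+ b) :- (c :+ d) := (a :- c) :+ (b :- d)) refl

Δ^-*-periodic : ∀ L k a f → (λ t → a (t ℕ.+ L)) ≗⁺ a →
  Δ^ L k (λ t → a t * f t) ≗⁺ λ t → a t * Δ^ L k f t
Δ^-*-periodic L zero    a f a-per n = refl
Δ^-*-periodic L (suc k) a f a-per n = trans
  (Δ^-cong L k (λ n → trans (cong (λ x → x * f (suc n ℕ.+ L) - a (suc n) * f (suc n)) (a-per n))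
                            (factor (a (suc n)) (f (suc n ℕ.+ L)) (f (suc n)))) n)
  (Δ^-*-periodic L k a (Δ L f) a-per n)
  where
  open +-*-Solver
  factor : ∀ a b c → a * b - a * c ≡ a * (b - c)
  factor = solve 3 (λ a b c → a :* b :- a :* c := a :* (b :- c)) refl

Δ^-Δ : ∀ L k f t → Δ^ L (suc k) f t ≡ Δ L (Δ^ L k f) t
Δ^-Δ L zero    f t = refl
Δ^-Δ L (suc k) f t = Δ^-Δ L k (Δ L f) t

Δ^-shift : ∀ L k a f → Δ^ L k (λ t → f (t ℕ.+ a)) ≗⁺ λ t → Δ^ L k f (t ℕ.+ a)
Δ^-shift L zero    a f n = refl
Δ^-shift L (suc k) a f n = trans
  (Δ^-cong L k (λ n → cong (λ t → f t - f (suc n ℕ.+ a)) (swap (suc n))) n)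
  (Δ^-shift L k a (Δ L f) n)
  where
  swap : ∀ t → t ℕ.+ L ℕ.+ a ≡ t ℕ.+ a ℕ.+ L
  swap t = trans (ℕ.+-assoc t L a) (trans (cong (t ℕ.+_) (ℕ.+-comm L a)) (sym (ℕ.+-assoc t a L)))

Ann : ℕ → ℕ → (ℕ → ℚ) → Set
Ann L k f = Δ^ L k f ≗⁺ λ _ → 0ℚ

Ann-cong : ∀ {L k f g} → f ≗⁺ g → Ann L k f → Ann L k g
Ann-cong {L} {k} f≗g annf n = trans (sym (Δ^-cong L k f≗g n)) (annf n)

Ann-+ : ∀ {L k f g} → Ann L k f → Ann L k g → Ann L k (λ t → f t + g t)
Ann-+ {L} {k} {f} {g} annf anng n = trans (Δ^-+ L k f g n) (cong₂ _+_ (annf n) (anng n))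

Ann-*ˡ : ∀ {L k f} a → Ann L k f → Ann L k (λ t → a * f t)
Ann-*ˡ {L} {k} {f} a annf n =
  trans (Δ^-*-periodic L k (λ _ → a) f (λ _ → refl) n) (trans (cong (a *_) (annf n)) (ℚ.*-zeroʳ a))

Ann-shift : ∀ {L k f} a → Ann L k f → Ann L k (λ t → f (t ℕ.+ a))
Ann-shift {L} {k} {f} a annf n = trans (Δ^-shift L k a f n) (annf (n ℕ.+ a))

Ann-suc : ∀ {L k f} → Ann L k f → Ann L (suc k) f
Ann-suc {L} {k} {f} annf n = trans (Δ^-Δ L k f (suc n)) (cong₂ _-_ (annf (n ℕ.+ L)) (annf n))

Ann-mono : ∀ {L k l f} → k ℕ.≤ l → Ann L k f → Ann L l f
Ann-mono {L} {k} {l} {f} k≤l = go (ℕ.≤⇒≤′ k≤l)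
  where
  go : ∀ {l} → k ℕ.≤′ l → Ann L k f → Ann L l f
  go (ℕ.≤′-reflexive refl)   annf = annf
  go {suc l} (ℕ.≤′-step k≤l) annf = Ann-suc {L} {l} {f} (go k≤l annf)

-- A difference with step c L telescopes into c shifted copies of the difference with step L. This
-- is what allows different periods to be replaced by a common multiple.
Ann-Δ-multiple : ∀ {K k} L f c → Ann K k (Δ L f) → Ann K k (Δ (c ℕ.* L) f)
Ann-Δ-multiple {K} {k} L f zero ann =
  Ann-cong {K} {k} (λ n → trans (ℚ.*-zeroˡ (Δ L f (suc n)))
    (sym (trans (cong (λ t → f t - f (suc n)) (ℕ.+-identityʳ (suc n))) (ℚ.+-inverseʳ (f (suc n))))))
    (Ann-*ˡ {K} {k} 0ℚ ann)
Ann-Δ-multiple {K} {k} L f (suc c) ann =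
  Ann-cong {K} {k} telescope
    (Ann-+ {K} {k} (Ann-shift {K} {k} L (Ann-Δ-multiple {K} {k} L f c ann)) ann)
  where
  open +-*-Solver
  cancel : ∀ x y z → (x - y) + (y - z) ≡ x - z
  cancel = solve 3 (λ x y z → (x :- y) :+ (y :- z) := x :- z) refl
  assoc : ∀ t → t ℕ.+ L ℕ.+ c ℕ.* L ≡ t ℕ.+ (L ℕ.+ c ℕ.* L)
  assoc t = ℕ.+-assoc t L (c ℕ.* L)
  telescope : (λ t → Δ (c ℕ.* L) f (t ℕ.+ L) + Δ L f t) ≗⁺ Δ (suc c ℕ.* L) f
  telescope n = trans (cancel (f (suc n ℕ.+ L ℕ.+ c ℕ.* L)) (f (suc n ℕ.+ L)) (f (suc n)))
    (cong (λ t → f t - f (suc n)) (assoc (suc n)))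

Ann-multiple : ∀ {L} k {f} c → Ann L k f → Ann (c ℕ.* L) k f
Ann-multiple     zero        c ann = ann
Ann-multiple {L} (suc k) {f} c ann = Ann-Δ-multiple {c ℕ.* L} {k} L f c (Ann-multiple k c ann)

-- By Ann⇒polynomial below, QP k f says that f agrees at all positive arguments with a
-- quasi-polynomial of degree less than k.
QP : ℕ → (ℕ → ℚ) → Set
QP k f = ∃ λ L → 0 ℕ.< L × Ann L k f

QP-cong : ∀ {k f g} → f ≗⁺ g → QP k f → QP k g
QP-cong {k} f≗g (L , L>0 , ann) = L , L>0 , Ann-cong {L} {k} f≗g ann

QP-+ : ∀ {k f g} → QP k f → QP k g → QP k (λ t → f t + g t)
QP-+ {k} {f} {g} (L , L>0 , annf) (M , M>0 , anng) =
  M ℕ.* L , ℕ.*-mono-< M>0 L>0 ,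
  Ann-+ {M ℕ.* L} {k} (Ann-multiple k M annf)
    (subst (λ K → Ann K k g) (ℕ.*-comm L M) (Ann-multiple k L anng))

QP-*ˡ : ∀ {k f} a → QP k f → QP k (λ t → a * f t)
QP-*ˡ {k} a (L , L>0 , ann) = L , L>0 , Ann-*ˡ {L} {k} a ann

QP-mono : ∀ {k l f} → k ℕ.≤ l → QP k f → QP l f
QP-mono {k} {l} {f} k≤l (L , L>0 , ann) = L , L>0 , Ann-mono {L} {k} {l} {f} k≤l ann

-- Discrete integration. Both the period L of the difference and the step d are enlarged to L d,
-- after which the two kinds of difference operator coincide.
QP-Δ : ∀ {k f} d → 0 ℕ.< d → QP k (Δ d f) → QP (suc k) f
QP-Δ {k} {f} d d>0 (L , L>0 , ann) =
  L ℕ.* d , ℕ.*-mono-< L>0 d>0 ,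
  Ann-Δ-multiple {L ℕ.* d} {k} d f L
    (subst (λ K → Ann K k (Δ d f)) (ℕ.*-comm d L) (Ann-multiple k d ann))

QP-zero : ∀ {k f} → f ≗⁺ (λ _ → 0ℚ) → QP k f
QP-zero {k} {f} f≗0 = QP-mono {0} {k} {f} z≤n (1 , s≤s z≤n , f≗0)

-- From differences to coefficients

1/d*d≡1 : ∀ d .{{_ : ℕ.NonZero d}} → (+ 1) / d * κ (+ d) ≡ 1ℚ
1/d*d≡1 d@(suc d-1) = toℚᵘ-injective (ℚᵘ.≃-trans (toℚᵘ-homo-* ((+ 1) / d) (κ (+ d)))
  (ℚᵘ.≃-trans (ℚᵘ.*-cong (toℚᵘ-fromℚᵘ (ℚᵘ.mkℚᵘ (+ 1) d-1)) (κ-cong-≃ (+ d)))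
    (ℚᵘ.*≡* (trans (ℤ.*-identityʳ (+ 1 ℤ.* + d)) (cong (λ e → + 1 ℤ.* + e) (sym (ℕ.*-identityʳ d)))))))

pw : ℕ → ℕ → ℚ
pw k t = κ ((+ t) ℤ.^ k)

-- Iterated product rule: each of the k + 1 difference operators may be the one that hits the linear
-- factor, where it leaves the constant L and a shift by L.
leibniz : ∀ L k f → Δ^ L (suc k) (λ t → κ (+ t) * f t) ≗⁺
  λ t → κ (+ t) * Δ^ L (suc k) f t + κ (+ (suc k ℕ.* L)) * Δ^ L k f (t ℕ.+ L)
leibniz L zero f n = begin
  κ (+ (t ℕ.+ L)) * f (t ℕ.+ L) - κ (+ t) * f t
    ≡⟨ cong (λ x → x * f (t ℕ.+ L) - κ (+ t) * f t) (κ-+ (+ t) (+ L)) ⟩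
  (κ (+ t) + κ (+ L)) * f (t ℕ.+ L) - κ (+ t) * f t
    ≡⟨ product-rule (κ (+ t)) (κ (+ L)) (f (t ℕ.+ L)) (f t) ⟩
  κ (+ t) * Δ L f t + κ (+ L) * f (t ℕ.+ L)
    ≡⟨ cong (λ l → κ (+ t) * Δ L f t + κ (+ l) * f (t ℕ.+ L)) (ℕ.+-identityʳ L) ⟨
  κ (+ t) * Δ L f t + κ (+ (1 ℕ.* L)) * f (t ℕ.+ L) ∎
  where
  t = suc n
  open +-*-Solver
  product-rule : ∀ s l a b → (s + l) * a - s * b ≡ s * (a - b) + l * a
  product-rule = solve 4 (λ s l a b → (s :+ l) :* a :- s :* b := s :* (a :- b) :+ l :* a) refl
leibniz L (suc k) f n = begin
  Δ^ L (suc k) (Δ L (λ t → κ (+ t) * f t)) t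
    ≡⟨ Δ^-cong L (suc k) {Δ L (λ t → κ (+ t) * f t)} {λ t → κ (+ t) * Δ L f t + κ (+ L) * f (t ℕ.+ L)} (λ n → trans (leibniz L 0 f n)
         (cong (λ l → κ (+ suc n) * Δ L f (suc n) + κ (+ l) * f (suc n ℕ.+ L)) (ℕ.+-identityʳ L))) n ⟩
  Δ^ L (suc k) (λ t → κ (+ t) * Δ L f t + κ (+ L) * f (t ℕ.+ L)) t
    ≡⟨ Δ^-+ L (suc k) (λ t → κ (+ t) * Δ L f t) (λ t → κ (+ L) * f (t ℕ.+ L)) n ⟩
  Δ^ L (suc k) (λ t → κ (+ t) * Δ L f t) t + Δ^ L (suc k) (λ t → κ (+ L) * f (t ℕ.+ L)) t
    ≡⟨ cong₂ _+_ (leibniz L k (Δ L f) n)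
         (trans (Δ^-*-periodic L (suc k) (λ _ → κ (+ L)) (λ t → f (t ℕ.+ L)) (λ _ → refl) n)
                (cong (κ (+ L) *_) (Δ^-shift L (suc k) L f n))) ⟩
  (κ (+ t) * A + κ (+ (suc k ℕ.* L)) * B) + κ (+ L) * B
    ≡⟨ collect (κ (+ t) * A) (κ (+ (suc k ℕ.* L))) B (κ (+ L)) ⟩
  κ (+ t) * A + (κ (+ L) + κ (+ (suc k ℕ.* L))) * B
    ≡⟨ cong (λ x → κ (+ t) * A + x * B) (κ-+ (+ L) (+ (suc k ℕ.* L))) ⟨
  κ (+ t) * A + κ (+ (suc (suc k) ℕ.* L)) * B ∎
  where
  t = suc n
  A = Δ^ L (suc (suc k)) f t
  B = Δ^ L (suc k) f (t ℕ.+ L)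
  open +-*-Solver
  collect : ∀ x y b l → (x + y * b) + l * b ≡ x + (l + y) * b
  collect = solve 4 (λ x y b l → (x :+ y :* b) :+ l :* b := x :+ (l :+ y) :* b) refl

-- This is k! L^k, in the recursive form that `leibniz` produces.
ΔPower : ℕ → ℕ → ℕ
ΔPower L zero    = 1
ΔPower L (suc k) = suc k ℕ.* L ℕ.* ΔPower L k

Δ^-pw : ∀ L k → Δ^ L k (pw k) ≗⁺ λ _ → κ (+ ΔPower L k)
Δ^-pw L zero    n = refl
Δ^-pw L (suc k) n = begin
  Δ^ L (suc k) (pw (suc k)) t
    ≡⟨ Δ^-cong L (suc k) {pw (suc k)} {λ t → κ (+ t) * pw k t} (λ n → κ-* (+ suc n) ((+ suc n) ℤ.^ k)) n ⟩
  Δ^ L (suc k) (λ t → κ (+ t) * pw k t) t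
    ≡⟨ leibniz L k (pw k) n ⟩
  κ (+ t) * Δ^ L (suc k) (pw k) t + κ (+ (suc k ℕ.* L)) * Δ^ L k (pw k) (t ℕ.+ L)
    ≡⟨ cong₂ (λ x y → κ (+ t) * x + κ (+ (suc k ℕ.* L)) * y)
         (trans (Δ^-Δ L k (pw k) t) (trans (cong₂ _-_ (Δ^-pw L k (n ℕ.+ L)) (Δ^-pw L k n))
           (ℚ.+-inverseʳ (κ (+ ΔPower L k)))))
         (Δ^-pw L k (n ℕ.+ L)) ⟩
  κ (+ t) * 0ℚ + κ (+ (suc k ℕ.* L)) * κ (+ ΔPower L k)
    ≡⟨ cong₂ _+_ (ℚ.*-zeroʳ (κ (+ t)))
         (trans (sym (κ-* (+ (suc k ℕ.* L)) (+ ΔPower L k))) (cong κ (sym (ℤ.pos-* (suc k ℕ.* L) (ΔPower L k))))) ⟩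
  0ℚ + κ (+ ΔPower L (suc k))
    ≡⟨ ℚ.+-identityˡ (κ (+ ΔPower L (suc k))) ⟩
  κ (+ ΔPower L (suc k)) ∎
  where t = suc n

ΔPower≢0 : ∀ L k .{{_ : ℕ.NonZero L}} → ℕ.NonZero (ΔPower L k)
ΔPower≢0 L zero    = _
ΔPower≢0 L (suc k) = ℕ.m*n≢0 (suc k ℕ.* L) (ΔPower L k) {{ℕ.m*n≢0 (suc k) L}} {{ΔPower≢0 L k}}

ΔPower-1 : ∀ k → ΔPower 1 k ≡ k !
ΔPower-1 zero    = refl
ΔPower-1 (suc k) = cong₂ ℕ._*_ (ℕ.*-identityʳ (suc k)) (ΔPower-1 k)

-- Extension of a periodic function from the natural numbers to the integers.

module _ {A : Set} (p : ℕ → A) (L : ℕ) (p-periodic : ∀ n → p (n ℕ.+ L) ≡ p n) where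

  p-+-multiple : ∀ n k → p (n ℕ.+ k ℕ.* L) ≡ p n
  p-+-multiple n zero    = cong p (ℕ.+-identityʳ n)
  p-+-multiple n (suc k) = trans (cong p (sym (ℕ.+-assoc n L (k ℕ.* L))))
    (trans (p-+-multiple (n ℕ.+ L) k) (p-periodic n))

  p-cong-mod : ∀ a b z → + a ≡ + b ℤ.+ z ℤ.* + L → p a ≡ p b
  p-cong-mod a b (+ k) eq = trans (cong p (ℤ.+-injective (trans eq
    (trans (cong (λ y → + b ℤ.+ y) (sym (ℤ.pos-* k L))) (sym (ℤ.pos-+ b (k ℕ.* L))))))) (p-+-multiple b k)
  p-cong-mod a b -[1+ k ] eq = sym (p-cong-mod b a (+ suc k) (begin
    + b
      ≡⟨ undo (+ b) (-[1+ k ]) (+ L) ⟩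
    (+ b ℤ.+ -[1+ k ] ℤ.* + L) ℤ.+ + suc k ℤ.* + L
      ≡⟨ cong (λ y → y ℤ.+ + suc k ℤ.* + L) eq ⟨
    + a ℤ.+ + suc k ℤ.* + L ∎))
    where
    open ℤ.+-*-Solver
    undo : ∀ b z l → b ≡ (b ℤ.+ z ℤ.* l) ℤ.+ ℤ.- z ℤ.* l
    undo = solve 3 (λ b z l → b := (b :+ z :* l) :+ :- z :* l) refl

  module _ .{{_ : ℕ.NonZero L}} where

    -- The shift by one is there because `p n` records the value belonging to the positive argument
    -- `suc n`.
    extend : ℤ → A
    extend z = p ((z ℤ.- + 1) ℤ.%ℕ L)

    extend-suc : ∀ n → extend (+ suc n) ≡ p n
    extend-suc n = sym (trans (cong p (ℕ.m≡m%n+[m/n]*n n L)) (p-+-multiple (n ℕ.% L) (n ℕ./ L)))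

    extend-periodic : ∀ z → extend (z ℤ.+ + L) ≡ extend z
    extend-periodic z = p-cong-mod a b (q ℤ.+ + 1 ℤ.- q′) (begin
      + a
        ≡⟨ isolate (+ a) q′ (+ L) ⟩
      (+ a ℤ.+ q′ ℤ.* + L) ℤ.- q′ ℤ.* + L
        ≡⟨ cong (λ y → y ℤ.- q′ ℤ.* + L) (ℤ.a≡a%ℕn+[a/ℕn]*n (z ℤ.+ + L ℤ.- + 1) L) ⟨
      (z ℤ.+ + L ℤ.- + 1) ℤ.- q′ ℤ.* + L
        ≡⟨ reorder z (+ L) (q′ ℤ.* + L) ⟩
      (z ℤ.- + 1) ℤ.+ + L ℤ.- q′ ℤ.* + L
        ≡⟨ cong (λ y → y ℤ.+ + L ℤ.- q′ ℤ.* + L) (ℤ.a≡a%ℕn+[a/ℕn]*n (z ℤ.- + 1) L) ⟩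
      (+ b ℤ.+ q ℤ.* + L) ℤ.+ + L ℤ.- q′ ℤ.* + L
        ≡⟨ collect (+ b) q q′ (+ L) ⟩
      + b ℤ.+ (q ℤ.+ + 1 ℤ.- q′) ℤ.* + L ∎)
      where
      a  = (z ℤ.+ + L ℤ.- + 1) ℤ.%ℕ L
      q′ = (z ℤ.+ + L ℤ.- + 1) ℤ./ℕ L
      b  = (z ℤ.- + 1) ℤ.%ℕ L
      q  = (z ℤ.- + 1) ℤ./ℕ L
      open ℤ.+-*-Solver
      isolate : ∀ a q l → a ≡ (a ℤ.+ q ℤ.* l) ℤ.- q ℤ.* l
      isolate = solve 3 (λ a q l → a := (a :+ q :* l) :- q :* l) refl
      reorder : ∀ z l y → (z ℤ.+ l ℤ.- + 1) ℤ.- y ≡ (z ℤ.- + 1) ℤ.+ l ℤ.- y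
      reorder = solve 3 (λ z l y → (z :+ l :- con (+ 1)) :- y := (z :- con (+ 1)) :+ l :- y) refl
      collect : ∀ b q r l → (b ℤ.+ q ℤ.* l) ℤ.+ l ℤ.- r ℤ.* l ≡ b ℤ.+ (q ℤ.+ + 1 ℤ.- r) ℤ.* l
      collect = solve 4 (λ b q r l → (b :+ q :* l) :+ l :- r :* l := b :+ (q :+ con (+ 1) :- r) :* l) refl

setAt : {A : Set} → ℕ → A → (ℕ → A) → ℕ → A
setAt k a c i with i ℕ.≟ k
... | yes _ = a
... | no  _ = c i

setAt-≡ : ∀ {A : Set} k (a : A) c → setAt k a c k ≡ a
setAt-≡ k a c with k ℕ.≟ k
... | yes _   = refl
... | no  k≢k = contradiction refl k≢k

setAt-≢ : ∀ {A : Set} {k} (a : A) c {i} → i ≢ k → setAt k a c i ≡ c i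
setAt-≢ {k = k} a c {i} i≢k with i ℕ.≟ k
... | yes i≡k = contradiction i≡k i≢k
... | no  _   = refl

polynomial : (ℕ → ℤ → ℚ) → ℕ → ℤ → ℚ
polynomial c k z = ∑[ i < k ] (c (toℕ i) z * κ (z ℤ.^ toℕ i))

polynomial-setAt : ∀ c k a z →
  polynomial (setAt k a c) (suc k) z ≡ polynomial c k z + a z * κ (z ℤ.^ k)
polynomial-setAt c k a z = trans (sum-init-last term) (cong₂ _+_
  (sum-cong-≗ λ i → cong₂ (λ b j → b z * κ (z ℤ.^ j))
     (trans (cong (setAt k a c) (Fin.toℕ-inject₁ i)) (setAt-≢ a c (ℕ.<⇒≢ (Fin.toℕ<n i))))
     (Fin.toℕ-inject₁ i))
  (cong₂ (λ b j → b z * κ (z ℤ.^ j))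
     (trans (cong (setAt k a c) (Fin.toℕ-fromℕ k)) (setAt-≡ k a c))
     (Fin.toℕ-fromℕ k)))
  where
  term : Fin (suc k) → ℚ
  term i = setAt k a c (toℕ i) z * κ (z ℤ.^ toℕ i)

-- Peels off the top coefficient: Δ^k f is L-periodic, and Δ^k t^k is the constant ΔPower L k.
Ann⇒polynomial : ∀ L .{{_ : ℕ.NonZero L}} k f → Ann L k f →
  ∃ λ c → (∀ i z → c i (z ℤ.+ + L) ≡ c i z) × (∀ n → f (suc n) ≡ polynomial c k (+ suc n))
Ann⇒polynomial L zero    f ann = (λ _ _ → 0ℚ) , (λ _ _ → refl) , ann
Ann⇒polynomial L (suc k) f ann =
  let c , c-per , g≡ = Ann⇒polynomial L k g annihilated in
  setAt k top c ,
  (λ i z → periodic′ c c-per i z) ,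
  (λ n → trans (split (f (suc n)) (top (+ suc n) * pw k (suc n)))
    (trans (cong (_+ top (+ suc n) * pw k (suc n)) (g≡ n))
           (sym (polynomial-setAt c k top (+ suc n)))))
  where
  instance
    _ = ΔPower≢0 L k
  inv = (+ 1) / ΔPower L k

  p : ℕ → ℚ
  p n = Δ^ L k f (suc n) * inv

  p-periodic : ∀ n → p (n ℕ.+ L) ≡ p n
  p-periodic n = cong (_* inv) (x-y≡0⇒x≡y (Δ^ L k f (suc n ℕ.+ L)) (Δ^ L k f (suc n)) (trans (sym (Δ^-Δ L k f (suc n))) (ann n)))
    where
    x-y≡0⇒x≡y : ∀ x y → x - y ≡ 0ℚ → x ≡ y
    x-y≡0⇒x≡y x y eq = trans (shuffle x y) (trans (cong (_+ y) eq) (ℚ.+-identityˡ y))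
      where
      open +-*-Solver
      shuffle : ∀ x y → x ≡ (x - y) + y
      shuffle = solve 2 (λ x y → x := (x :- y) :+ y) refl

  top : ℤ → ℚ
  top = extend p L p-periodic

  topℕ : ℕ → ℚ
  topℕ t = top (+ t)

  g : ℕ → ℚ
  g t = f t - top (+ t) * pw k t

  annihilated : Ann L k g
  annihilated n = begin
    Δ^ L k g t
      ≡⟨ Δ^-cong L k (λ n → cong (λ x → f (suc n) + x) (neg≡-1* (top (+ suc n)) (pw k (suc n)))) n ⟩
    Δ^ L k (λ t → f t + - 1ℚ * (top (+ t) * pw k t)) t
      ≡⟨ Δ^-+ L k f (λ t → - 1ℚ * (top (+ t) * pw k t)) n ⟩
    F + Δ^ L k (λ t → - 1ℚ * (top (+ t) * pw k t)) t
      ≡⟨ cong (λ x → F + x) (Δ^-*-periodic L k (λ _ → - 1ℚ) (λ t → top (+ t) * pw k t) (λ _ → refl) n) ⟩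
    F + - 1ℚ * Δ^ L k (λ t → top (+ t) * pw k t) t
      ≡⟨ cong (λ x → F + - 1ℚ * x) (Δ^-*-periodic L k topℕ (pw k) (λ n → extend-periodic p L p-periodic (+ suc n)) n) ⟩
    F + - 1ℚ * (top (+ t) * Δ^ L k (pw k) t)
      ≡⟨ cong₂ (λ x y → F + - 1ℚ * (x * y)) (extend-suc p L p-periodic n) (Δ^-pw L k n) ⟩
    F + - 1ℚ * (F * inv * κ (+ ΔPower L k))
      ≡⟨ cong (λ x → F + - 1ℚ * x) (ℚ.*-assoc F inv (κ (+ ΔPower L k))) ⟩
    F + - 1ℚ * (F * (inv * κ (+ ΔPower L k)))
      ≡⟨ cong (λ x → F + - 1ℚ * (F * x)) (1/d*d≡1 (ΔPower L k)) ⟩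
    F + - 1ℚ * (F * 1ℚ)
      ≡⟨ vanish F ⟩
    0ℚ ∎
    where
    t = suc n
    F = Δ^ L k f t
    open +-*-Solver
    neg≡-1* : ∀ x y → - (x * y) ≡ - 1ℚ * (x * y)
    neg≡-1* = solve 2 (λ x y → :- (x :* y) := con (- 1ℚ) :* (x :* y)) refl
    vanish : ∀ x → x + - 1ℚ * (x * 1ℚ) ≡ 0ℚ
    vanish = solve 1 (λ x → x :+ con (- 1ℚ) :* (x :* con 1ℚ) := con 0ℚ) refl

  split : ∀ x y → x ≡ (x - y) + y
  split = solve 2 (λ x y → x := (x :- y) :+ y) refl
    where open +-*-Solver

  periodic′ : ∀ c → (∀ i z → c i (z ℤ.+ + L) ≡ c i z) →
    ∀ i z → setAt k top c i (z ℤ.+ + L) ≡ setAt k top c i z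
  periodic′ c c-per i z with i ℕ.≟ k
  ... | yes _ = extend-periodic p L p-periodic z
  ... | no  _ = c-per i z

-- With a t^d subtracted, what remains has only coefficients below degree d, so the constant a can
-- be inserted as the coefficient of t^d.
QP⇒IsQuasipolynomial : ∀ f d a → a ≢ 0ℚ →
  QP d (λ t → κ (+ f t) - a * pw d t) → IsQuasipolynomial f d a
QP⇒IsQuasipolynomial f d a a≢0 (suc l , _ , ann)
  with c , c-per , eq ← Ann⇒polynomial (suc l) d (λ t → κ (+ f t) - a * pw d t) ann =
  record
    { coeff     = λ i → setAt d (λ _ → a) c (toℕ i)
    ; periodic  = λ i → suc l , s≤s z≤n , per (toℕ i)
    ; leading≢0 = + 0 , λ a≡0 → a≢0 (trans (sym (top (+ 0))) a≡0)
    }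
  , evaluates
  , top
  where
  top : ∀ z → setAt d (λ _ → a) c (toℕ (fromℕ d)) z ≡ a
  top z = cong (λ b → b z) (trans (cong (setAt d (λ _ → a) c) (Fin.toℕ-fromℕ d)) (setAt-≡ d (λ _ → a) c))
  per : ∀ i z → setAt d (λ _ → a) c i (z ℤ.+ + suc l) ≡ setAt d (λ _ → a) c i z
  per i z with i ℕ.≟ d
  ... | yes _ = refl
  ... | no  _ = c-per i z
  open +-*-Solver
  split : ∀ x y → x ≡ (x - y) + y
  split = solve 2 (λ x y → x := (x :- y) :+ y) refl
  evaluates : ∀ t → 0 ℕ.< t → κ (+ f t) ≡ polynomial (setAt d (λ _ → a) c) (suc d) (+ t)
  evaluates t@(suc n) _ = trans (split (κ (+ f t)) (a * pw d t))
    (trans (cong (_+ a * pw d t) (eq n)) (sym (polynomial-setAt c d (λ _ → a) (+ t))))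

-- Sums over the points of an open simplicial cone

module Cones
  {X : Set} (_⊕_ : X → X → X)
  (⊕-assoc : ∀ x y z → (x ⊕ y) ⊕ z ≡ x ⊕ (y ⊕ z))
  (⊕-comm : ∀ x y → x ⊕ y ≡ y ⊕ x)
  (w : X → ℕ) (w-⊕ : ∀ x y → w (x ⊕ y) ≡ w x ℕ.+ w y)
  where

  ⊕-swap : ∀ u v x → u ⊕ (v ⊕ x) ≡ v ⊕ (u ⊕ x)
  ⊕-swap u v x = begin
    u ⊕ (v ⊕ x) ≡⟨ ⊕-assoc u v x ⟨
    (u ⊕ v) ⊕ x ≡⟨ cong (_⊕ x) (⊕-comm u v) ⟩
    (v ⊕ u) ⊕ x ≡⟨ ⊕-assoc v u x ⟩
    v ⊕ (u ⊕ x) ∎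

  add : ℕ → X → X → X
  add zero    v x = x
  add (suc j) v x = add j v (v ⊕ x)

  add-⊕ : ∀ j v u x → add j v (u ⊕ x) ≡ u ⊕ add j v x
  add-⊕ zero    v u x = refl
  add-⊕ (suc j) v u x = trans (cong (add j v) (⊕-swap v u x)) (add-⊕ j v u (v ⊕ x))

  add-comm : ∀ i j u v x → add i u (add j v x) ≡ add j v (add i u x)
  add-comm zero    j u v x = refl
  add-comm (suc i) j u v x = trans (cong (add i u) (sym (add-⊕ j v u x))) (add-comm i j u v (u ⊕ x))

  add-+ : ∀ i j v x → add i v (add j v x) ≡ add (j ℕ.+ i) v x
  add-+ i zero    v x = refl
  add-+ i (suc j) v x = add-+ i j v (v ⊕ x)

  add-sum : ∀ j u v x → add j (u ⊕ v) x ≡ add j v (add j u x)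
  add-sum zero    u v x = refl
  add-sum (suc j) u v x = begin
    add j (u ⊕ v) ((u ⊕ v) ⊕ x)   ≡⟨ cong (add j (u ⊕ v)) (trans (cong (_⊕ x) (⊕-comm u v)) (⊕-assoc v u x)) ⟩
    add j (u ⊕ v) (v ⊕ (u ⊕ x))   ≡⟨ add-sum j u v (v ⊕ (u ⊕ x)) ⟩
    add j v (add j u (v ⊕ (u ⊕ x))) ≡⟨ cong (add j v) (add-⊕ j u v (u ⊕ x)) ⟩
    add j v (v ⊕ add j u (u ⊕ x)) ∎

  w-add : ∀ {v} → 0 ℕ.< w v → ∀ j x → j ℕ.+ w x ℕ.≤ w (add j v x)
  w-add     v>0 zero    x = ℕ.≤-refl
  w-add {v} v>0 (suc j) x = ℕ.≤-trans
    (ℕ.≤-trans (ℕ.≤-reflexive (sym (ℕ.+-suc j (w x))))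
      (ℕ.+-monoʳ-≤ j (ℕ.≤-trans (ℕ.+-monoˡ-≤ (w x) v>0) (ℕ.≤-reflexive (sym (w-⊕ v x))))))
    (w-add v>0 j (v ⊕ x))

  w-⊕>0 : ∀ {u} v → 0 ℕ.< w u → 0 ℕ.< w (u ⊕ v)
  w-⊕>0 {u} v u>0 = ℕ.<-≤-trans u>0 (ℕ.≤-trans (ℕ.m≤m+n (w u) (w v)) (ℕ.≤-reflexive (sym (w-⊕ u v))))

  Supp : ℕ → (X → ℚ) → Set
  Supp N f = ∀ x → N ℕ.< w x → f x ≡ 0ℚ

  Supp-⊕ : ∀ {N f} v → Supp N f → Supp N (λ x → f (v ⊕ x))
  Supp-⊕ v supp x N<wx =
    supp (v ⊕ x) (ℕ.<-≤-trans N<wx (ℕ.≤-trans (ℕ.m≤n+m (w x) (w v)) (ℕ.≤-reflexive (sym (w-⊕ v x)))))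

  -- G N v f x = Σ_{1 ≤ j ≤ N} f (j v + x), which is the sum over all j ≥ 1 when f is supported
  -- on weights at most N and v has positive weight.
  G : ℕ → X → (X → ℚ) → X → ℚ
  G zero    v f x = 0ℚ
  G (suc N) v f x = f (v ⊕ x) + G N v f (v ⊕ x)

  G-cong : ∀ N v {f g} x → (∀ j → f (add (suc j) v x) ≡ g (add (suc j) v x)) → G N v f x ≡ G N v g x
  G-cong zero    v x f≗g = refl
  G-cong (suc N) v x f≗g = cong₂ _+_ (f≗g 0) (G-cong N v (v ⊕ x) (λ j → f≗g (suc j)))

  G-+ : ∀ N v f g x → G N v (λ y → f y + g y) x ≡ G N v f x + G N v g x
  G-+ zero    v f g x = refl
  G-+ (suc N) v f g x = trans (cong (λ b → f (v ⊕ x) + g (v ⊕ x) + b) (G-+ N v f g (v ⊕ x)))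
    (interchange (f (v ⊕ x)) (g (v ⊕ x)) (G N v f (v ⊕ x)) (G N v g (v ⊕ x)))
    where
    open +-*-Solver
    interchange : ∀ a b c d → (a + b) + (c + d) ≡ (a + c) + (b + d)
    interchange = solve 4 (λ a b c d → (a :+ b) :+ (c :+ d) := (a :+ c) :+ (b :+ d)) refl

  G-*ʳ : ∀ N v f a x → G N v (λ y → f y * a) x ≡ G N v f x * a
  G-*ʳ zero    v f a x = sym (ℚ.*-zeroˡ a)
  G-*ʳ (suc N) v f a x = trans (cong (λ b → f (v ⊕ x) * a + b) (G-*ʳ N v f a (v ⊕ x)))
    (sym (ℚ.*-distribʳ-+ a (f (v ⊕ x)) (G N v f (v ⊕ x))))

  G-⊕ : ∀ N v f u x → G N v (λ y → f (u ⊕ y)) x ≡ G N v f (u ⊕ x)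
  G-⊕ zero    v f u x = refl
  G-⊕ (suc N) v f u x = cong₂ _+_ (cong f (⊕-swap u v x))
    (trans (G-⊕ N v f u (v ⊕ x)) (cong (G N v f) (⊕-swap u v x)))

  G-last : ∀ N v f x → G (suc N) v f x ≡ G N v f x + f (add (suc N) v x)
  G-last zero    v f x = ℚ.+-comm (f (v ⊕ x)) 0ℚ
  G-last (suc N) v f x = trans (cong (λ b → f (v ⊕ x) + b) (G-last N v f (v ⊕ x)))
    (sym (ℚ.+-assoc (f (v ⊕ x)) (G N v f (v ⊕ x)) _))

  -- Thanks to the support condition the truncated sum obeys the recurrence of the infinite one: the
  -- additional term with coefficient N + 1 has weight above N and vanishes.
  G-step : ∀ {N v f} → 0 ℕ.< w v → Supp N f → ∀ x → G N v f x ≡ f (v ⊕ x) + G N v f (v ⊕ x)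
  G-step {N} {v} {f} v>0 supp x = sym (begin
    f (v ⊕ x) + G N v f (v ⊕ x)       ≡⟨ G-last N v f x ⟩
    G N v f x + f (add (suc N) v x)   ≡⟨ cong (λ b → G N v f x + b) (supp _ (ℕ.≤-trans (ℕ.m≤m+n (suc N) (w x)) (w-add v>0 (suc N) x))) ⟩
    G N v f x + 0ℚ                    ≡⟨ ℚ.+-identityʳ (G N v f x) ⟩
    G N v f x                         ∎)

  Supp-G : ∀ {M f} N v → Supp M f → Supp M (G N v f)
  Supp-G zero    v supp x M<wx = refl
  Supp-G (suc N) v supp x M<wx =
    cong₂ _+_ (Supp-⊕ v supp x M<wx) (Supp-⊕ v (Supp-G N v supp) x M<wx)

  -- Each use of the recurrence raises the weight by at least one, until it exceeds N and both
  -- functions vanish. Identities between iterated sums are proved through this lemma instead of by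
  -- reindexing.
  recurrence-unique : ∀ {N v} {A B : X → ℚ} (h : X → ℚ) → 0 ℕ.< w v → Supp N A → Supp N B →
    (∀ x → A x ≡ h x + A (v ⊕ x)) → (∀ x → B x ≡ h x + B (v ⊕ x)) → ∀ x → A x ≡ B x
  recurrence-unique {N} {v} {A} {B} h v>0 suppA suppB recA recB x = go (suc N) x
    (ℕ.m≤m+n (suc N) (w x))
    where
    go : ∀ j x → N ℕ.< j ℕ.+ w x → A x ≡ B x
    go zero    x N<wx = trans (suppA x N<wx) (sym (suppB x N<wx))
    go (suc j) x N<   = trans (recA x) (trans (cong (λ b → h x + b) (go j (v ⊕ x) N<′)) (sym (recB x)))
      where
      N<′ : N ℕ.< j ℕ.+ w (v ⊕ x)
      N<′ = ℕ.<-≤-trans N< (ℕ.≤-trans (ℕ.≤-reflexive (sym (ℕ.+-suc j (w x))))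
        (ℕ.+-monoʳ-≤ j (ℕ.≤-trans (ℕ.+-monoˡ-≤ (w x) v>0) (ℕ.≤-reflexive (sym (w-⊕ v x))))))

  module _ {N : ℕ} {f : X → ℚ} (supp : Supp N f) where

    -- Both iterated sums satisfy the same recurrence along u, whose inhomogeneous part is the sum
    -- over v started at u ⊕ x.
    G-comm : ∀ {u v} → 0 ℕ.< w u → 0 ℕ.< w v → ∀ x → G N u (G N v f) x ≡ G N v (G N u f) x
    G-comm {u} {v} u>0 v>0 = recurrence-unique (λ x → G N v f (u ⊕ x)) u>0
      (Supp-G N u (Supp-G N v supp)) (Supp-G N v (Supp-G N u supp))
      (G-step u>0 (Supp-G N v supp))
      (λ x → begin
        G N v (G N u f) x
          ≡⟨ G-cong N v x (λ j → G-step u>0 supp (add (suc j) v x)) ⟩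
        G N v (λ y → f (u ⊕ y) + G N u f (u ⊕ y)) x
          ≡⟨ G-+ N v (λ y → f (u ⊕ y)) (λ y → G N u f (u ⊕ y)) x ⟩
        G N v (λ y → f (u ⊕ y)) x + G N v (λ y → G N u f (u ⊕ y)) x
          ≡⟨ cong₂ _+_ (G-⊕ N v f u x) (G-⊕ N v (G N u f) u x) ⟩
        G N v f (u ⊕ x) + G N v (G N u f) (u ⊕ x) ∎)

    -- The pairs (i, j) of positive integers split into i > j, i < j and i = j.
    G-split : ∀ {u v} → 0 ℕ.< w u → 0 ℕ.< w v → ∀ x → G N u (G N v f) x ≡
      G N u (G N (u ⊕ v) f) x + G N (u ⊕ v) (G N v f) x + G N (u ⊕ v) f x
    G-split {u} {v} u>0 v>0 = recurrence-unique (λ x → K (u ⊕ x)) u>0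
      (Supp-G N u suppK) supp-rhs (G-step u>0 suppK) rec-rhs
      where
      c = u ⊕ v
      K = G N v f
      H = G N c f
      suppK : Supp N K
      suppK = Supp-G N v supp
      suppH : Supp N H
      suppH = Supp-G N c supp
      c>0 : 0 ℕ.< w c
      c>0 = w-⊕>0 v u>0
      c⊕ : ∀ x → c ⊕ x ≡ v ⊕ (u ⊕ x)
      c⊕ x = trans (⊕-assoc u v x) (⊕-swap u v x)
      open +-*-Solver
      supp-rhs : Supp N (λ x → G N u H x + G N c K x + H x)
      supp-rhs x N<wx = cong₂ _+_ (cong₂ _+_ (Supp-G N u suppH x N<wx) (Supp-G N c suppK x N<wx)) (suppH x N<wx)

      -- Both sides sum f over x + i u + j v with 1 ≤ i ≤ j: the left side writes i u + j v as i c +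
      -- (j - i) v, the right side as u + (i - 1) c + (j - i + 1) v.
      diagonal : ∀ x → G N c K x + H x ≡ K (u ⊕ x) + G N c K (u ⊕ x)
      diagonal = recurrence-unique (λ x → K (u ⊕ x)) c>0
        (λ x N<wx → cong₂ _+_ (Supp-G N c suppK x N<wx) (suppH x N<wx))
        (λ x N<wx → cong₂ _+_ (Supp-⊕ u suppK x N<wx) (Supp-⊕ u (Supp-G N c suppK) x N<wx))
        (λ x → begin
          G N c K x + H x
            ≡⟨ cong₂ _+_ (G-step c>0 suppK x) (G-step c>0 supp x) ⟩
          (K (c ⊕ x) + G N c K (c ⊕ x)) + (f (c ⊕ x) + H (c ⊕ x))
            ≡⟨ regroup (K (c ⊕ x)) (G N c K (c ⊕ x)) (f (c ⊕ x)) (H (c ⊕ x)) ⟩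
          (f (c ⊕ x) + K (c ⊕ x)) + (G N c K (c ⊕ x) + H (c ⊕ x))
            ≡⟨ cong (_+ (G N c K (c ⊕ x) + H (c ⊕ x)))
                 (trans (cong (λ y → f y + K y) (c⊕ x)) (sym (G-step v>0 supp (u ⊕ x)))) ⟩
          K (u ⊕ x) + (G N c K (c ⊕ x) + H (c ⊕ x)) ∎)
        (λ x → cong (λ b → K (u ⊕ x) + b) (begin
          G N c K (u ⊕ x)
            ≡⟨ G-step c>0 suppK (u ⊕ x) ⟩
          K (c ⊕ (u ⊕ x)) + G N c K (c ⊕ (u ⊕ x))
            ≡⟨ cong (λ y → K y + G N c K y) (⊕-swap c u x) ⟩
          K (u ⊕ (c ⊕ x)) + G N c K (u ⊕ (c ⊕ x)) ∎))
        where
        regroup : ∀ a b d e → (a + b) + (d + e) ≡ (d + a) + (b + e)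
        regroup = solve 4 (λ a b d e → (a :+ b) :+ (d :+ e) := (d :+ a) :+ (b :+ e)) refl

      rec-rhs : ∀ x → G N u H x + G N c K x + H x ≡
        K (u ⊕ x) + (G N u H (u ⊕ x) + G N c K (u ⊕ x) + H (u ⊕ x))
      rec-rhs x = begin
        G N u H x + G N c K x + H x
          ≡⟨ ℚ.+-assoc (G N u H x) (G N c K x) (H x) ⟩
        G N u H x + (G N c K x + H x)
          ≡⟨ cong₂ _+_ (G-step u>0 suppH x) (diagonal x) ⟩
        (H (u ⊕ x) + G N u H (u ⊕ x)) + (K (u ⊕ x) + G N c K (u ⊕ x))
          ≡⟨ regroup (H (u ⊕ x)) (G N u H (u ⊕ x)) (K (u ⊕ x)) (G N c K (u ⊕ x)) ⟩
        K (u ⊕ x) + (G N u H (u ⊕ x) + G N c K (u ⊕ x) + H (u ⊕ x)) ∎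
        where
        regroup : ∀ a b d e → (a + b) + (d + e) ≡ d + (b + e + a)
        regroup = solve 4 (λ a b d e → (a :+ b) :+ (d :+ e) := d :+ (b :+ e :+ a)) refl

  -- The sum runs over tuples of coefficients between 1 and N, so a point contributes once for every
  -- tuple that yields it.
  cnt : ℕ → (X → ℚ) → List X → X → ℚ
  cnt N f []       = f
  cnt N f (v ∷ vs) = G N v (cnt N f vs)

  Supp-cnt : ∀ {N f} vs → Supp N f → Supp N (cnt N f vs)
  Supp-cnt     []       supp = supp
  Supp-cnt {N} (v ∷ vs) supp = Supp-G N v (Supp-cnt vs supp)

  PosWeights : List X → Set
  PosWeights = All (λ v → 0 ℕ.< w v)

  cnt-↭ : ∀ {N f us vs} → Supp N f → PosWeights us → us ↭ vs → ∀ x → cnt N f us x ≡ cnt N f vs x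
  cnt-↭ supp pos ↭.refl x = refl
  cnt-↭ {N} supp (_ ∷ pos) (↭.prep v p) x = G-cong N v x (λ j → cnt-↭ supp pos p (add (suc j) v x))
  cnt-↭ {N} {us = _ ∷ _ ∷ us} supp (u>0 ∷ v>0 ∷ pos) (↭.swap u v p) x =
    trans (G-comm (Supp-cnt us supp) u>0 v>0 x)
      (G-cong N v x (λ j → G-cong N u _ (λ i → cnt-↭ supp pos p _)))
  cnt-↭ supp pos (↭.trans p q) x = trans (cnt-↭ supp pos p x) (cnt-↭ supp (↭.All-resp-↭ p pos) q x)

  cnt-split : ∀ {N f u v} vs → Supp N f → 0 ℕ.< w u → 0 ℕ.< w v → ∀ x →
    cnt N f (u ∷ v ∷ vs) x ≡
    cnt N f (u ∷ (u ⊕ v) ∷ vs) x + cnt N f ((u ⊕ v) ∷ v ∷ vs) x + cnt N f ((u ⊕ v) ∷ vs) x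
  cnt-split vs supp = G-split (Supp-cnt vs supp)

  -- Cone x vs y: y - x is a combination of vs with positive integer coefficients.
  Cone : X → List X → X → Set
  Cone x []       y = x ≡ y
  Cone x (v ∷ vs) y = ∃ λ j → Cone (add (suc j) v x) vs y

  Cone-inhabited : ∀ x vs → ∃ (Cone x vs)
  Cone-inhabited x []       = x , refl
  Cone-inhabited x (v ∷ vs) with y , y∈ ← Cone-inhabited (v ⊕ x) vs = y , 0 , y∈

  Cone-↭ : ∀ {us vs x y} → us ↭ vs → Cone x us y → Cone x vs y
  Cone-↭ ↭.refl y∈ = y∈
  Cone-↭ (↭.prep v p) (j , y∈) = j , Cone-↭ p y∈
  Cone-↭ {x = x} (↭.swap {xs = us} u v p) (i , j , y∈) =
    j , i , Cone-↭ p (subst (λ z → Cone z us _) (add-comm (suc j) (suc i) v u x) y∈)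
  Cone-↭ (↭.trans p q) y∈ = Cone-↭ q (Cone-↭ p y∈)

  -- Stored indices are coefficients minus one, so (i + 1) u + (j + 1) (u + v) = (i + j + 2) u + (j
  -- + 1) v becomes the pair `i + suc j`, `j`.
  Cone-split-> : ∀ {u v vs x y} → Cone x (u ∷ (u ⊕ v) ∷ vs) y → Cone x (u ∷ v ∷ vs) y
  Cone-split-> {u} {v} {vs} {x} {y} (i , j , y∈) = i ℕ.+ suc j , j ,
    subst (λ z → Cone z vs y) (trans (add-sum (suc j) u v _)
      (cong (add (suc j) v) (add-+ (suc j) (suc i) u x))) y∈

  Cone-split-< : ∀ {u v vs x y} → Cone x ((u ⊕ v) ∷ v ∷ vs) y → Cone x (u ∷ v ∷ vs) y
  Cone-split-< {u} {v} {vs} {x} {y} (i , j , y∈) = i , i ℕ.+ suc j ,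
    subst (λ z → Cone z vs y) (trans (cong (add (suc j) v) (add-sum (suc i) u v x))
      (add-+ (suc j) (suc i) v _)) y∈

  Cone-split-≡ : ∀ {u v vs x y} → Cone x ((u ⊕ v) ∷ vs) y → Cone x (u ∷ v ∷ vs) y
  Cone-split-≡ {u} {v} {vs} {x} {y} (i , y∈) = i , i ,
    subst (λ z → Cone z vs y) (add-sum (suc i) u v x) y∈

  cnt-cong : ∀ N {f g} vs x → (∀ {y} → Cone x vs y → f y ≡ g y) → cnt N f vs x ≡ cnt N g vs x
  cnt-cong N []       x f≗g = f≗g refl
  cnt-cong N (v ∷ vs) x f≗g = G-cong N v x (λ j → cnt-cong N vs (add (suc j) v x) (λ y∈ → f≗g (j , y∈)))

  cnt-*ʳ : ∀ N f a vs x → cnt N (λ y → f y * a) vs x ≡ cnt N f vs x * a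
  cnt-*ʳ N f a []       x = refl
  cnt-*ʳ N f a (v ∷ vs) x = trans (G-cong N v x (λ j → cnt-*ʳ N f a vs (add (suc j) v x))) (G-*ʳ N v (cnt N f vs) a x)

  level : ℕ → X → ℚ
  level t x with w x ℕ.≟ t
  ... | yes _ = 1ℚ
  ... | no  _ = 0ℚ

  level-≡ : ∀ {t x} → w x ≡ t → level t x ≡ 1ℚ
  level-≡ {t} {x} wx≡t with w x ℕ.≟ t
  ... | yes _    = refl
  ... | no  wx≢t = contradiction wx≡t wx≢t

  level-≢ : ∀ {t x} → w x ≢ t → level t x ≡ 0ℚ
  level-≢ {t} {x} wx≢t with w x ℕ.≟ t
  ... | yes wx≡t = contradiction wx≡t wx≢t
  ... | no  _    = refl

  Supp-level : ∀ t → Supp t (level t)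
  Supp-level t x t<wx = level-≢ (≢-sym (ℕ.<⇒≢ t<wx))

  level-⊕ : ∀ t v x → level (t ℕ.+ w v) (v ⊕ x) ≡ level t x
  level-⊕ t v x with w x ℕ.≟ t
  ... | yes wx≡t = level-≡ (trans (w-⊕ v x) (trans (ℕ.+-comm (w v) (w x)) (cong (ℕ._+ w v) wx≡t)))
  ... | no  wx≢t = level-≢ (λ eq → wx≢t (ℕ.+-cancelʳ-≡ (w v) (w x) t
                     (trans (ℕ.+-comm (w x) (w v)) (trans (sym (w-⊕ v x)) eq))))

  total : List X → X → ℕ → ℚ
  total vs x t = cnt t (level t) vs x

  Supp-total : ∀ vs t → Supp t (λ x → total vs x t)
  Supp-total vs t = Supp-cnt vs (Supp-level t)

  -- The start and the level both move by v, which matches the terms one by one. The truncation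
  -- bound moves with the level, however, so the comparison is made through the recurrence.
  total-⊕ : ∀ {us} → PosWeights us → ∀ v t x → total us (v ⊕ x) (t ℕ.+ w v) ≡ total us x t
  total-⊕ {[]}     []          v t x = level-⊕ t v x
  total-⊕ {u ∷ us} (u>0 ∷ pos) v t   = recurrence-unique (λ x → total us (u ⊕ x) t) u>0
    (λ x t<wx → Supp-total (u ∷ us) (t ℕ.+ w v) (v ⊕ x)
       (ℕ.<-≤-trans (ℕ.+-monoˡ-< (w v) t<wx) (ℕ.≤-reflexive (trans (ℕ.+-comm (w x) (w v)) (sym (w-⊕ v x))))))
    (Supp-total (u ∷ us) t)
    (λ x → begin
      total (u ∷ us) (v ⊕ x) (t ℕ.+ w v)
        ≡⟨ G-step u>0 (Supp-total us (t ℕ.+ w v)) (v ⊕ x) ⟩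
      total us (u ⊕ (v ⊕ x)) (t ℕ.+ w v) + total (u ∷ us) (u ⊕ (v ⊕ x)) (t ℕ.+ w v)
        ≡⟨ cong (λ y → total us y (t ℕ.+ w v) + total (u ∷ us) y (t ℕ.+ w v)) (⊕-swap u v x) ⟩
      total us (v ⊕ (u ⊕ x)) (t ℕ.+ w v) + total (u ∷ us) (v ⊕ (u ⊕ x)) (t ℕ.+ w v)
        ≡⟨ cong (_+ total (u ∷ us) (v ⊕ (u ⊕ x)) (t ℕ.+ w v)) (total-⊕ pos v t (u ⊕ x)) ⟩
      total us (u ⊕ x) t + total (u ∷ us) (v ⊕ (u ⊕ x)) (t ℕ.+ w v) ∎)
    (G-step u>0 (Supp-total us t))

  -- Subtracting one v identifies the points of weight t + w v with coefficient of v at least 2 with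
  -- all points of weight t. The difference thus counts those with coefficient 1, in which v no
  -- longer varies.
  Δ-total : ∀ {v vs} → PosWeights (v ∷ vs) → ∀ x t → Δ (w v) (total (v ∷ vs) x) t ≡ total vs x t
  Δ-total {v} {vs} pos@(v>0 ∷ vs>0) x t = begin
    total (v ∷ vs) x (t ℕ.+ w v) - total (v ∷ vs) x t
      ≡⟨ cong (_- total (v ∷ vs) x t) (G-step v>0 (Supp-total vs (t ℕ.+ w v)) x) ⟩
    (total vs (v ⊕ x) (t ℕ.+ w v) + total (v ∷ vs) (v ⊕ x) (t ℕ.+ w v)) - total (v ∷ vs) x t
      ≡⟨ cong₂ (λ a b → (a + b) - total (v ∷ vs) x t) (total-⊕ vs>0 v t x) (total-⊕ pos v t x) ⟩
    (total vs x t + total (v ∷ vs) x t) - total (v ∷ vs) x t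
      ≡⟨ cancel (total vs x t) (total (v ∷ vs) x t) ⟩
    total vs x t ∎
    where
    open +-*-Solver
    cancel : ∀ a b → (a + b) - b ≡ a
    cancel = solve 2 (λ a b → (a :+ b) :- b := a) refl

  module _ {o : X} (w-o : w o ≡ 0) where

    QP-total : ∀ {vs} → PosWeights vs → QP (length vs) (total vs o)
    -- Without generators the only point is `o`, of weight 0, so the count is zero at every positive
    -- t.
    QP-total {[]}     []  = QP-zero {0} {total [] o} (λ n → level-≢ {suc n} (λ eq → ℕ.0≢1+n (trans (sym w-o) eq)))
    QP-total {v ∷ vs} pos@(v>0 ∷ vs>0) = QP-Δ {length vs} {total (v ∷ vs) o} (w v) v>0
      (QP-cong {length vs} {total vs o} (λ n → sym (Δ-total pos o (suc n))) (QP-total vs>0))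

    total-singleton : ∀ {v} → w v ≡ 1 → ∀ n → total (v ∷ []) o (suc n) ≡ 1ℚ
    total-singleton {v} wv≡1 n = begin
      total (v ∷ []) o (suc n)
        ≡⟨ G-step v>0 (Supp-level (suc n)) o ⟩
      level (suc n) (v ⊕ o) + total (v ∷ []) (v ⊕ o) (suc n)
        ≡⟨ cong (λ t → level t (v ⊕ o) + total (v ∷ []) (v ⊕ o) t) (trans (ℕ.+-comm 1 n) (cong (n ℕ.+_) (sym wv≡1))) ⟩
      level (n ℕ.+ w v) (v ⊕ o) + total (v ∷ []) (v ⊕ o) (n ℕ.+ w v)
        ≡⟨ cong₂ _+_ (level-⊕ n v o) (total-⊕ (v>0 ∷ []) v n o) ⟩
      level n o + total (v ∷ []) o n
        ≡⟨ base n ⟩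
      1ℚ ∎
      where
      v>0 : 0 ℕ.< w v
      v>0 = ℕ.≤-reflexive (sym wv≡1)
      base : ∀ n → level n o + total (v ∷ []) o n ≡ 1ℚ
      base zero    = trans (ℚ.+-identityʳ (level 0 o)) (level-≡ w-o)
      base (suc n) = trans (cong₂ _+_ (level-≢ {suc n} (λ eq → ℕ.0≢1+n (trans (sym w-o) eq)))
        (total-singleton wv≡1 n)) refl

    -- With unit weights every step-1 difference removes one generator; the last one alone has
    -- exactly one point of each positive weight. This determines the leading coefficient.
    Δ^-total : ∀ {v vs} → All (λ u → w u ≡ 1) (v ∷ vs) → Δ^ 1 (length vs) (total (v ∷ vs) o) ≗⁺ λ _ → 1ℚ
    Δ^-total {v} {[]}     (wv≡1 ∷ _) = total-singleton wv≡1
    Δ^-total {v} {u ∷ us} (wv≡1 ∷ ws) n = trans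
      (Δ^-cong 1 (length us) {Δ 1 (total (v ∷ u ∷ us) o)} {total (u ∷ us) o}
        (λ n → subst (λ d → Δ d (total (v ∷ u ∷ us) o) (suc n) ≡ total (u ∷ us) o (suc n)) wv≡1
          (Δ-total (All.map (λ eq → ℕ.≤-reflexive (sym eq)) (wv≡1 ∷ ws)) o (suc n))) n)
      (Δ^-total ws n)

-- Subdivision into cones on which a linear form has constant sign

bit : ℕ → ℕ → ℕ
bit M a with a ℕ.≤? M
... | yes _ = 0
... | no  _ = 1

bit-≤ : ∀ {M a} → a ℕ.≤ M → bit M a ≡ 0
bit-≤ {M} {a} a≤M with a ℕ.≤? M
... | yes _   = refl
... | no  a≰M = contradiction a≤M a≰M

bit-> : ∀ {M a} → M ℕ.< a → bit M a ≡ 1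
bit-> {M} {a} M<a with a ℕ.≤? M
... | yes a≤M = contradiction M<a (ℕ.≤⇒≯ a≤M)
... | no  _   = refl

-- Every list is reached from lists on which the additive form f has a constant sign by
-- un-splitting.  A vector u maximising |f| is paired successively with the vectors v with
-- f v of the opposite sign: either v is replaced by u ⊕ v, on which f has the sign of f u,
-- or u is replaced by u ⊕ v, which leaves fewer vectors of maximal |f|.
module Subdivision
  {X : Set} (_⊕_ : X → X → X) (Good : List X → Set)
  (good-↭ : ∀ {us vs} → us ↭ vs → Good us → Good vs)
  (good-split : ∀ {u v vs} → Good (u ∷ (u ⊕ v) ∷ vs) → Good ((u ⊕ v) ∷ v ∷ vs) →
     Good ((u ⊕ v) ∷ vs) → Good (u ∷ v ∷ vs))
  (∣f∣ : X → ℕ)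
  where

  -- Under the bound M + 1 this counts the vectors of maximal |f|. Written as a sum of zeros and
  -- ones, it inherits permutation invariance from sums.
  #big : ℕ → List X → ℕ
  #big M xs = ℕ.sum (map (bit M ∘ ∣f∣) xs)

  #big-↭ : ∀ M {xs ys} → xs ↭ ys → #big M xs ≡ #big M ys
  #big-↭ M xs↭ys = ℕ.sum-↭ (↭.map⁺ (bit M ∘ ∣f∣) xs↭ys)

  Bounded : ℕ → List X → Set
  Bounded M = All (λ x → ∣f∣ x ℕ.≤ M)

  module _
    {f : X → ℤ} (f-⊕ : ∀ u v → f (u ⊕ v) ≡ f u ℤ.+ f v) (∣f∣≡ : ∀ x → ℤ.∣ f x ∣ ≡ ∣f∣ x)
    (good-nonneg : ∀ {xs} → All (λ x → 0ℤ ℤ.≤ f x) xs → Good xs)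
    {M n : ℕ} (fewer : ∀ {xs} → Bounded (suc M) xs → #big M xs ℕ.≤ n → Good xs)
    {u : X} (fu≡ : f u ≡ + suc M)
    where

    -- `done` collects the vectors already on the side of u. For f v = -(a + 1) the value f (u ⊕ v)
    -- = M - a lies between 0 and M. The piece that keeps u moves u ⊕ v to `done`; the other two
    -- have lost the maximal vector u and fall under `fewer`.
    sweep : ∀ todo done → Bounded (suc M) todo → Bounded (suc M) done →
      All (λ x → 0ℤ ℤ.≤ f x) done → #big M (todo ++ done) ℕ.≤ n → Good (u ∷ todo ++ done)
    sweep []         done _ _ nonneg _ =
      good-nonneg (subst (0ℤ ℤ.≤_) (sym fu≡) (+≤+ z≤n) ∷ nonneg)
    sweep (v ∷ todo) done (bv ∷ bt) bd nonneg #big≤n with f v in fv≡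
    ... | + a = good-↭ (↭.prep u (↭.shift v todo done))
      (sweep todo (v ∷ done) bt (bv ∷ bd) (subst (0ℤ ℤ.≤_) (sym fv≡) (+≤+ z≤n) ∷ nonneg)
        (subst (ℕ._≤ n) (sym (#big-↭ M (↭.shift v todo done))) #big≤n))
    ... | -[1+ a ] = good-split
      (good-↭ (↭.prep u (↭.shift c todo done))
        (sweep todo (c ∷ done) bt (ℕ.m≤n⇒m≤1+n c≤M ∷ bd) (subst (0ℤ ℤ.≤_) (sym fc≡) (+≤+ z≤n) ∷ nonneg)
          (subst (ℕ._≤ n) (sym (#big-↭ M (↭.shift c todo done))) c-rest≤n)))
      (fewer (ℕ.m≤n⇒m≤1+n c≤M ∷ bv ∷ All.++⁺ bt bd)
        (subst (λ b → b ℕ.+ #big M (v ∷ todo ++ done) ℕ.≤ n) (sym (bit-≤ c≤M)) #big≤n))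
      (fewer (ℕ.m≤n⇒m≤1+n c≤M ∷ All.++⁺ bt bd) c-rest≤n)
      where
      c = u ⊕ v
      a≤M : a ℕ.≤ M
      a≤M = ℕ.≤-pred (subst (ℕ._≤ suc M) (trans (sym (∣f∣≡ v)) (cong ℤ.∣_∣ fv≡)) bv)
      fc≡ : f c ≡ + (M ℕ.∸ a)
      fc≡ = trans (f-⊕ u v) (trans (cong₂ ℤ._+_ fu≡ fv≡) (ℤ.⊖-≥ (s≤s a≤M)))
      c≤M : ∣f∣ c ℕ.≤ M
      c≤M = subst (ℕ._≤ M) (trans (cong ℤ.∣_∣ (sym fc≡)) (∣f∣≡ c)) (ℕ.m∸n≤m M a)
      c-rest≤n : #big M (c ∷ todo ++ done) ℕ.≤ n
      c-rest≤n = subst (λ b → b ℕ.+ #big M (todo ++ done) ℕ.≤ n) (sym (bit-≤ c≤M))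
        (ℕ.≤-trans (ℕ.m≤n+m (#big M (todo ++ done)) (bit M (∣f∣ v))) #big≤n)

  module _
    {f : X → ℤ} (f-⊕ : ∀ u v → f (u ⊕ v) ≡ f u ℤ.+ f v) (∣f∣≡ : ∀ x → ℤ.∣ f x ∣ ≡ ∣f∣ x)
    (good-nonneg : ∀ {xs} → All (λ x → 0ℤ ℤ.≤ f x) xs → Good xs)
    (good-nonpos : ∀ {xs} → All (λ x → 0ℤ ℤ.≤ ℤ.- f x) xs → Good xs)
    where

    -- Outer induction on the bound for |f|, inner induction on the number of vectors that attain
    -- it. At bound 0 the form vanishes on the whole list.
    good-bounded : ∀ M {xs} → Bounded M xs → Good xs
    good-bounded zero    bounded = good-nonneg (All.map (λ {x} x≤0 →
      ℤ.≤-reflexive (sym (ℤ.∣i∣≡0⇒i≡0 (trans (∣f∣≡ x) (ℕ.n≤0⇒n≡0 x≤0))))) bounded)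
    good-bounded (suc M) bounded = go _ bounded ℕ.≤-refl
      where
      go : ∀ n {xs} → Bounded (suc M) xs → #big M xs ℕ.≤ n → Good xs
      extract : ∀ n u {xs} → M ℕ.< ∣f∣ u → Bounded (suc M) (u ∷ xs) → #big M (u ∷ xs) ℕ.≤ n → Good (u ∷ xs)

      go n {xs} bounded #big≤n with Any.any? (λ x → M ℕ.<? ∣f∣ x) xs
      ... | no  none = good-bounded M (All.map ℕ.≮⇒≥ (All.¬Any⇒All¬ xs none))
      ... | yes some with u , u∈xs , M<u ← find some with ys , zs , refl ← ∈-∃++ u∈xs
        = good-↭ (↭-sym (↭.shift u ys zs)) (extract n u M<u (↭.All-resp-↭ (↭.shift u ys zs) bounded)
            (subst (ℕ._≤ n) (#big-↭ M (↭.shift u ys zs)) #big≤n))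

      extract zero u {xs} M<u bounded #big≤n
        with () ← subst (λ b → b ℕ.+ #big M xs ℕ.≤ 0) (bit-> M<u) #big≤n
      extract (suc n) u {xs} M<u (bu ∷ bs) #big≤n = subst (λ ys → Good (u ∷ ys)) (++-identityʳ xs) swept
        where
        fewer : #big M (xs ++ []) ℕ.≤ n
        fewer = subst (λ ys → #big M ys ℕ.≤ n) (sym (++-identityʳ xs))
          (ℕ.≤-pred (subst (λ b → b ℕ.+ #big M xs ℕ.≤ suc n) (bit-> M<u) #big≤n))
        ∣fu∣≡ : ℤ.∣ f u ∣ ≡ suc M
        ∣fu∣≡ = trans (∣f∣≡ u) (ℕ.≤-antisym bu M<u)
        swept : Good (u ∷ xs ++ [])
        swept with ℤ.+∣i∣≡i⊎+∣i∣≡-i (f u)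
        ... | inj₁ +∣fu∣≡fu = sweep {f} f-⊕ ∣f∣≡ good-nonneg (go n)
          (trans (sym +∣fu∣≡fu) (cong +_ ∣fu∣≡)) xs [] bs [] [] fewer
        -- A negative f u is treated by sweeping with -f, which has the same absolute values and
        -- hence the same measure.
        ... | inj₂ +∣fu∣≡-fu = sweep {ℤ.-_ ∘ f}
          (λ u v → trans (cong ℤ.-_ (f-⊕ u v)) (ℤ.neg-distrib-+ (f u) (f v)))
          (λ x → trans (ℤ.∣-i∣≡∣i∣ (f x)) (∣f∣≡ x)) good-nonpos (go n)
          (trans (sym +∣fu∣≡-fu) (cong +_ ∣fu∣≡)) xs [] bs [] [] fewer

    good : ∀ xs → Good xs
    good xs = good-bounded (proj₁ (bound xs)) (proj₂ (bound xs))
      where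
      bound : ∀ xs → ∃ λ M → Bounded M xs
      bound []       = 0 , []
      bound (x ∷ xs) with M , bounded ← bound xs = ∣f∣ x ℕ.⊔ M ,
        ℕ.m≤m⊔n (∣f∣ x) M ∷ All.map (λ b → ℕ.≤-trans b (ℕ.m≤n⊔m (∣f∣ x) M)) bounded

-- Quasi-polynomiality of weighted sums over a cone.

module Counting
  {X : Set} (_⊕_ : X → X → X)
  (⊕-assoc : ∀ x y z → (x ⊕ y) ⊕ z ≡ x ⊕ (y ⊕ z))
  (⊕-comm : ∀ x y → x ⊕ y ≡ y ⊕ x)
  (w : X → ℕ) (w-⊕ : ∀ x y → w (x ⊕ y) ≡ w x ℕ.+ w y)
  (o : X) (w-o : w o ≡ 0)
  where

  open Cones _⊕_ ⊕-assoc ⊕-comm w w-⊕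

  record Form : Set where
    field
      ⟦_⟧  : X → ℤ
      ⟦⟧-⊕ : ∀ x y → ⟦_⟧ (x ⊕ y) ≡ ⟦_⟧ x ℤ.+ ⟦_⟧ y
      ⟦⟧-o : ⟦_⟧ o ≡ 0ℤ

  open Form

  -- The first alternative also records the values on the generators, since that is what contradicts
  -- `nonzero` on a generic cone.
  EverywhereOrNowhereZero : (X → ℤ) → List X → Set
  EverywhereOrNowhereZero f vs =
    (All (λ v → f v ≡ 0ℤ) vs × (∀ {y} → Cone o vs y → f y ≡ 0ℤ)) ⊎ (∀ {y} → Cone o vs y → f y ≢ 0ℤ)

  module _ (f : X → ℤ) (f-⊕ : ∀ x y → f (x ⊕ y) ≡ f x ℤ.+ f y) where

    add-≤ : ∀ j {v} x → 0ℤ ℤ.≤ f v → f x ℤ.≤ f (add j v x)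
    add-≤ zero        x v≥0 = ℤ.≤-refl
    add-≤ (suc j) {v} x v≥0 = ℤ.≤-trans
      (ℤ.≤-trans (ℤ.≤-reflexive (sym (ℤ.+-identityˡ (f x))))
        (ℤ.≤-trans (ℤ.+-monoˡ-≤ (f x) v≥0) (ℤ.≤-reflexive (sym (f-⊕ v x)))))
      (add-≤ j (v ⊕ x) v≥0)

    add-< : ∀ j {v} x → 0ℤ ℤ.< f v → f x ℤ.< f (add (suc j) v x)
    add-< j {v} x v>0 = ℤ.<-≤-trans
      (ℤ.≤-<-trans (ℤ.≤-reflexive (sym (ℤ.+-identityˡ (f x))))
        (ℤ.<-≤-trans (ℤ.+-monoˡ-< (f x) v>0) (ℤ.≤-reflexive (sym (f-⊕ v x)))))
      (add-≤ j (v ⊕ x) (ℤ.<⇒≤ v>0))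

    Cone-≤ : ∀ {x y vs} → All (λ v → 0ℤ ℤ.≤ f v) vs → Cone x vs y → f x ℤ.≤ f y
    Cone-≤     []          refl     = ℤ.≤-refl
    Cone-≤ {x} (v≥0 ∷ vs≥0) (j , y∈) = ℤ.≤-trans (add-≤ (suc j) x v≥0) (Cone-≤ vs≥0 y∈)

    Cone-< : ∀ {x y vs} → All (λ v → 0ℤ ℤ.≤ f v) vs → Any (λ v → f v ≢ 0ℤ) vs → Cone x vs y → f x ℤ.< f y
    Cone-< {x} (v≥0 ∷ vs≥0) (here v≢0)  (j , y∈) =
      ℤ.<-≤-trans (add-< j x (ℤ.≤∧≢⇒< v≥0 (≢-sym v≢0))) (Cone-≤ vs≥0 y∈)
    Cone-< {x} (v≥0 ∷ vs≥0) (there any) (j , y∈) =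
      ℤ.≤-<-trans (add-≤ (suc j) x v≥0) (Cone-< vs≥0 any y∈)

    add-≡ : ∀ j {v} x → f v ≡ 0ℤ → f (add j v x) ≡ f x
    add-≡ zero        x v≡0 = refl
    add-≡ (suc j) {v} x v≡0 = trans (add-≡ j (v ⊕ x) v≡0)
      (trans (f-⊕ v x) (trans (cong (ℤ._+ f x) v≡0) (ℤ.+-identityˡ (f x))))

    Cone-≡ : ∀ {x y vs} → All (λ v → f v ≡ 0ℤ) vs → Cone x vs y → f y ≡ f x
    Cone-≡     []         refl     = refl
    Cone-≡ {x} (v≡0 ∷ vs≡0) (j , y∈) = trans (Cone-≡ vs≡0 y∈) (add-≡ (suc j) x v≡0)

    -- All coefficients are at least 1, so a single generator with a positive value makes the form
    -- positive on the whole open cone.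
    Cone-constant-sign : ∀ {vs} → f o ≡ 0ℤ → All (λ v → 0ℤ ℤ.≤ f v) vs →
      EverywhereOrNowhereZero f vs
    Cone-constant-sign {vs} fo≡0 vs≥0 with Any.any? (λ v → ¬? (f v ℤ.≟ 0ℤ)) vs
    ... | yes any  = inj₂ (λ y∈ → ≢-sym (ℤ.<⇒≢ (ℤ.≤-<-trans (ℤ.≤-reflexive (sym fo≡0)) (Cone-< vs≥0 any y∈))))
    ... | no  none = inj₁ (vs≡0 , λ y∈ → trans (Cone-≡ vs≡0 y∈) fo≡0)
      where
      vs≡0 : All (λ v → f v ≡ 0ℤ) vs
      vs≡0 = All.map (λ {v} → decidable-stable (f v ℤ.≟ 0ℤ)) (All.¬Any⇒All¬ vs none)

  weighted : (X → ℚ) → List X → ℕ → ℚ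
  weighted φ vs t = cnt t (λ x → level t x * φ x) vs o

  Supp-weighted : ∀ t (φ : X → ℚ) → Supp t (λ x → level t x * φ x)
  Supp-weighted t φ x t<wx = trans (cong (_* φ x) (Supp-level t x t<wx)) (ℚ.*-zeroˡ (φ x))

  weighted-constant : ∀ {φ a} vs t → (∀ {y} → Cone o vs y → φ y ≡ a) → weighted φ vs t ≡ total vs o t * a
  weighted-constant {φ} {a} vs t φ≡a = trans
    (cnt-cong t {_} {λ x → level t x * a} vs o (λ {y} y∈ → cong (level t y *_) (φ≡a y∈)))
    (cnt-*ʳ t (level t) a vs o)

  SameZero : X → X → Form → Set
  SameZero y z F = (⟦ F ⟧ y ≡ 0ℤ → ⟦ F ⟧ z ≡ 0ℤ) × (⟦ F ⟧ z ≡ 0ℤ → ⟦ F ⟧ y ≡ 0ℤ)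

  -- The case of one generator too many: φ vanishes off the hyperplanes defined by Fs, and no
  -- such hyperplane contains the cone.
  record Generic (d : ℕ) (φ : X → ℚ) (Fs : List Form) (vs : List X) : Set where
    field
      length≤  : length vs ℕ.≤ suc d
      vanishes : ∀ {y} → Cone o vs y → All (λ F → ⟦ F ⟧ y ≢ 0ℤ) Fs → φ y ≡ 0ℚ
      nonzero  : All (λ F → Any (λ v → ⟦ F ⟧ v ≢ 0ℤ) vs) Fs

  -- The invariant carried through the subdivision: on the cone φ depends only on which of the
  -- remaining forms vanish, and the cone either has at most d generators or is generic.
  record Admissible (d : ℕ) (φ : X → ℚ) (Fs : List Form) (vs : List X) : Set where
    field
      weights>0 : PosWeights vs
      invariant : ∀ {y z} → Cone o vs y → Cone o vs z → All (SameZero y z) Fs → φ y ≡ φ z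
      small     : length vs ℕ.≤ d ⊎ Generic d φ Fs vs

  open Generic
  open Admissible

  module _ {d : ℕ} {φ : X → ℚ} where

    admissible-↭ : ∀ {Fs us vs} → us ↭ vs → Admissible d φ Fs us → Admissible d φ Fs vs
    admissible-↭ {Fs} {us} {vs} σ adm = record
      { weights>0 = ↭.All-resp-↭ σ (weights>0 adm)
      ; invariant = λ y∈ z∈ → invariant adm (Cone-↭ (↭-sym σ) y∈) (Cone-↭ (↭-sym σ) z∈)
      ; small     = small′ (small adm)
      }
      where
      small′ : length us ℕ.≤ d ⊎ Generic d φ Fs us → length vs ℕ.≤ d ⊎ Generic d φ Fs vs
      small′ (inj₁ ≤d)  = inj₁ (subst (ℕ._≤ d) (↭.↭-length σ) ≤d)
      small′ (inj₂ gen) = inj₂ record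
        { length≤  = subst (ℕ._≤ suc d) (↭.↭-length σ) (length≤ gen)
        ; vanishes = λ y∈ → vanishes gen (Cone-↭ (↭-sym σ) y∈)
        ; nonzero  = All.map (↭.Any-resp-↭ σ) (nonzero gen)
        }

    admissible-subcone : ∀ {Fs us vs} → (∀ {y} → Cone o vs y → Cone o us y) → PosWeights vs →
      length vs ℕ.≤ length us →
      (∀ {F} → Any (λ v → ⟦ F ⟧ v ≢ 0ℤ) us → Any (λ v → ⟦ F ⟧ v ≢ 0ℤ) vs) →
      Admissible d φ Fs us → Admissible d φ Fs vs
    admissible-subcone {Fs} {us} {vs} vs⊆us vs>0 ∣vs∣≤∣us∣ nz adm = record
      { weights>0 = vs>0
      ; invariant = λ y∈ z∈ → invariant adm (vs⊆us y∈) (vs⊆us z∈)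
      ; small     = small′ (small adm)
      }
      where
      small′ : length us ℕ.≤ d ⊎ Generic d φ Fs us → length vs ℕ.≤ d ⊎ Generic d φ Fs vs
      small′ (inj₁ ≤d)  = inj₁ (ℕ.≤-trans ∣vs∣≤∣us∣ ≤d)
      small′ (inj₂ gen) = inj₂ record
        { length≤  = ℕ.≤-trans ∣vs∣≤∣us∣ (length≤ gen)
        ; vanishes = λ y∈ → vanishes gen (vs⊆us y∈)
        ; nonzero  = All.map (λ {F} → nz {F}) (nonzero gen)
        }

    module _ {Fs : List Form} {u v : X} {vs : List X} (adm : Admissible d φ Fs (u ∷ v ∷ vs)) where

      u⊕v>0 : 0 ℕ.< w (u ⊕ v)
      u⊕v>0 = w-⊕>0 v (All.head (weights>0 adm))

      -- The vectors u, u ⊕ v determine the values of an additive form on u, v, so a form that is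
      -- zero on the new generators would be zero on the old ones.
      admissible-split-> : Admissible d φ Fs (u ∷ (u ⊕ v) ∷ vs)
      admissible-split-> with u>0 ∷ v>0 ∷ vs>0 ← weights>0 adm =
        admissible-subcone Cone-split-> (u>0 ∷ u⊕v>0 ∷ vs>0) ℕ.≤-refl (λ {F} → nz {F}) adm
        where
        nz : ∀ {F} → Any (λ v → ⟦ F ⟧ v ≢ 0ℤ) (u ∷ v ∷ vs) → Any (λ v → ⟦ F ⟧ v ≢ 0ℤ) (u ∷ (u ⊕ v) ∷ vs)
        nz     (here u≢0)          = here u≢0
        nz     (there (there any)) = there (there any)
        nz {F} (there (here v≢0)) with ⟦ F ⟧ u ℤ.≟ 0ℤ
        ... | no  u≢0 = here u≢0
        ... | yes u≡0 = there (here (λ eq → v≢0 (trans (sym (ℤ.+-identityˡ _))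
                          (trans (cong (ℤ._+ ⟦ F ⟧ v) (sym u≡0)) (trans (sym (⟦⟧-⊕ F u v)) eq)))))

      admissible-split-< : Admissible d φ Fs ((u ⊕ v) ∷ v ∷ vs)
      admissible-split-< with u>0 ∷ v>0 ∷ vs>0 ← weights>0 adm =
        admissible-subcone Cone-split-< (u⊕v>0 ∷ v>0 ∷ vs>0) ℕ.≤-refl (λ {F} → nz {F}) adm
        where
        nz : ∀ {F} → Any (λ v → ⟦ F ⟧ v ≢ 0ℤ) (u ∷ v ∷ vs) → Any (λ v → ⟦ F ⟧ v ≢ 0ℤ) ((u ⊕ v) ∷ v ∷ vs)
        nz     (there (here v≢0))  = there (here v≢0)
        nz     (there (there any)) = there (there any)
        nz {F} (here u≢0) with ⟦ F ⟧ v ℤ.≟ 0ℤ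
        ... | no  v≢0 = there (here v≢0)
        ... | yes v≡0 = here (λ eq → u≢0 (trans (sym (ℤ.+-identityʳ _))
                          (trans (cong (λ b → ⟦ F ⟧ u ℤ.+ b) (sym v≡0)) (trans (sym (⟦⟧-⊕ F u v)) eq))))

      -- The diagonal loses a generator, so its dimension is already small.
      admissible-split-≡ : Admissible d φ Fs ((u ⊕ v) ∷ vs)
      admissible-split-≡ with u>0 ∷ v>0 ∷ vs>0 ← weights>0 adm = record
        { weights>0 = u⊕v>0 ∷ vs>0
        ; invariant = λ y∈ z∈ → invariant adm (Cone-split-≡ y∈) (Cone-split-≡ z∈)
        ; small     = inj₁ (small′ (small adm))
        }
        where
        small′ : length (u ∷ v ∷ vs) ℕ.≤ d ⊎ Generic d φ Fs (u ∷ v ∷ vs) → length ((u ⊕ v) ∷ vs) ℕ.≤ d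
        small′ (inj₁ ≤d)  = ℕ.<⇒≤ ≤d
        small′ (inj₂ gen) = ℕ.≤-pred (length≤ gen)

    -- A form vanishing on the whole cone does not distinguish its points. It vanishes on all
    -- generators, which excludes the generic case and leaves at most d generators.
    drop-zero : ∀ {F Fs vs} → All (λ v → ⟦ F ⟧ v ≡ 0ℤ) vs → (∀ {y} → Cone o vs y → ⟦ F ⟧ y ≡ 0ℤ) →
      Admissible d φ (F ∷ Fs) vs → Admissible d φ Fs vs
    drop-zero {F} {Fs} {vs} vs≡0 ≡0 adm = record
      { weights>0 = weights>0 adm
      ; invariant = λ y∈ z∈ same → invariant adm y∈ z∈ (((λ _ → ≡0 z∈) , (λ _ → ≡0 y∈)) ∷ same)
      ; small     = inj₁ (small′ (small adm))
      }
      where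
      small′ : length vs ℕ.≤ d ⊎ Generic d φ (F ∷ Fs) vs → length vs ℕ.≤ d
      small′ (inj₁ ≤d)  = ≤d
      small′ (inj₂ gen) = contradiction vs≡0 (All.Any¬⇒¬All (All.head (nonzero gen)))

    drop-nonzero : ∀ {F Fs vs} → (∀ {y} → Cone o vs y → ⟦ F ⟧ y ≢ 0ℤ) →
      Admissible d φ (F ∷ Fs) vs → Admissible d φ Fs vs
    drop-nonzero {F} {Fs} {vs} ≢0 adm = record
      { weights>0 = weights>0 adm
      ; invariant = λ y∈ z∈ same → invariant adm y∈ z∈
          (((λ y≡0 → contradiction y≡0 (≢0 y∈)) , (λ z≡0 → contradiction z≡0 (≢0 z∈))) ∷ same)
      ; small     = small′ (small adm)
      }
      where
      small′ : length vs ℕ.≤ d ⊎ Generic d φ (F ∷ Fs) vs → length vs ℕ.≤ d ⊎ Generic d φ Fs vs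
      small′ (inj₁ ≤d)  = inj₁ ≤d
      small′ (inj₂ gen) = inj₂ record
        { length≤  = length≤ gen
        ; vanishes = λ y∈ nz → vanishes gen y∈ (≢0 y∈ ∷ nz)
        ; nonzero  = All.tail (nonzero gen)
        }

    -- Induction on the forms: the cone is subdivided until F has constant sign, and then F is
    -- dropped. With no form left φ is constant, and on a generic cone that constant is zero.
    QP-weighted : ∀ Fs vs → Admissible d φ Fs vs → QP d (weighted φ vs)
    QP-weighted [] vs adm with y₀ , y₀∈ ← Cone-inhabited o vs | small adm
    ... | inj₁ ≤d = QP-mono {length vs} {d} {weighted φ vs} ≤d
      (QP-cong {length vs} {λ t → φ y₀ * total vs o t} {weighted φ vs}
        (λ n → trans (ℚ.*-comm (φ y₀) (total vs o (suc n)))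
          (sym (weighted-constant vs (suc n) (λ y∈ → invariant adm y∈ y₀∈ []))))
        (QP-*ˡ {length vs} {total vs o} (φ y₀) (QP-total w-o (weights>0 adm))))
    ... | inj₂ gen = QP-zero {d} {weighted φ vs} (λ n →
      trans (weighted-constant vs (suc n) (λ y∈ → vanishes gen y∈ [])) (ℚ.*-zeroʳ (total vs o (suc n))))
    QP-weighted (F ∷ Fs) = good {⟦ F ⟧} (⟦⟧-⊕ F) (λ _ → refl)
      (λ {vs} vs≥0 adm → QP-weighted Fs vs (drop adm (Cone-constant-sign ⟦ F ⟧ (⟦⟧-⊕ F) (⟦⟧-o F) vs≥0)))
      (λ {vs} vs≤0 adm → QP-weighted Fs vs (drop adm (negated
        (Cone-constant-sign (ℤ.-_ ∘ ⟦ F ⟧)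
          (λ x y → trans (cong ℤ.-_ (⟦⟧-⊕ F x y)) (ℤ.neg-distrib-+ (⟦ F ⟧ x) (⟦ F ⟧ y)))
          (cong ℤ.-_ (⟦⟧-o F)) vs≤0))))
      where
      Good : List X → Set
      Good vs = Admissible d φ (F ∷ Fs) vs → QP d (weighted φ vs)

      drop : ∀ {vs} → Admissible d φ (F ∷ Fs) vs → EverywhereOrNowhereZero ⟦ F ⟧ vs → Admissible d φ Fs vs
      drop adm (inj₁ (vs≡0 , ≡0)) = drop-zero vs≡0 ≡0 adm
      drop adm (inj₂ ≢0)          = drop-nonzero ≢0 adm

      negated : ∀ {vs} → EverywhereOrNowhereZero (ℤ.-_ ∘ ⟦ F ⟧) vs → EverywhereOrNowhereZero ⟦ F ⟧ vs
      negated (inj₁ (vs≡0 , ≡0)) = inj₁ (All.map ℤ.neg-injective vs≡0 , λ y∈ → ℤ.neg-injective (≡0 y∈))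
      negated (inj₂ ≢0)          = inj₂ (λ y∈ eq → ≢0 y∈ (cong ℤ.-_ eq))

      good-↭ : ∀ {us vs} → us ↭ vs → Good us → Good vs
      good-↭ {us} {vs} σ good-us adm = QP-cong {d} {weighted φ us} {weighted φ vs}
        (λ n → cnt-↭ (Supp-weighted (suc n) φ) (weights>0 (admissible-↭ (↭-sym σ) adm)) σ o)
        (good-us (admissible-↭ (↭-sym σ) adm))

      good-split : ∀ {u v vs} → Good (u ∷ (u ⊕ v) ∷ vs) → Good ((u ⊕ v) ∷ v ∷ vs) →
        Good ((u ⊕ v) ∷ vs) → Good (u ∷ v ∷ vs)
      good-split {u} {v} {vs} g> g< g≡ adm with u>0 ∷ v>0 ∷ vs>0 ← weights>0 adm = QP-cong {d}
        {λ t → (weighted φ (u ∷ (u ⊕ v) ∷ vs) t + weighted φ ((u ⊕ v) ∷ v ∷ vs) t) + weighted φ ((u ⊕ v) ∷ vs) t}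
        {weighted φ (u ∷ v ∷ vs)}
        (λ n → sym (cnt-split vs (Supp-weighted (suc n) φ) u>0 v>0 o))
        (QP-+ {d} {λ t → weighted φ (u ∷ (u ⊕ v) ∷ vs) t + weighted φ ((u ⊕ v) ∷ v ∷ vs) t} {weighted φ ((u ⊕ v) ∷ vs)}
          (QP-+ {d} {weighted φ (u ∷ (u ⊕ v) ∷ vs)} {weighted φ ((u ⊕ v) ∷ v ∷ vs)}
            (g> (admissible-split-> adm)) (g< (admissible-split-< adm)))
          (g≡ (admissible-split-≡ adm)))

      open Subdivision _⊕_ Good good-↭ good-split (ℤ.∣_∣ ∘ ⟦ F ⟧) using (good)

-- Rulers as points of a cone

infixl 6 _⊕_

_⊕_ : ∀ {n} → Vec ℕ n → Vec ℕ n → Vec ℕ n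
_⊕_ = zipWith ℕ._+_

last-⊕ : ∀ {m} (x y : Vec ℕ (suc m)) → last (x ⊕ y) ≡ last x ℕ.+ last y
last-⊕ (_ ∷ [])    (_ ∷ [])    = refl
last-⊕ (_ ∷ a ∷ x) (_ ∷ b ∷ y) = last-⊕ (a ∷ x) (b ∷ y)

last-replicate : ∀ m (a : ℕ) → last (replicate (suc m) a) ≡ a
last-replicate zero    a = refl
last-replicate (suc m) a = last-replicate m a

module Rulers (m : ℕ) = Cones {Vec ℕ (suc m)} _⊕_
  (zipWith-assoc ℕ.+-assoc) (zipWith-comm ℕ.+-comm) last last-⊕

module RulerForms (m : ℕ) = Counting {Vec ℕ (suc m)} _⊕_
  (zipWith-assoc ℕ.+-assoc) (zipWith-comm ℕ.+-comm) last last-⊕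
  (replicate (suc m) 0) (last-replicate m 0)

-- The vectors (0, …, 0, 1, …, 1), i.e. the rulers with a single gap 1 and all others 0.
generators : ∀ m → List (Vec ℕ (suc m))
generators zero    = []
generators (suc m) = (0 ∷ replicate (suc m) 1) ∷ map (0 ∷_) (generators m)

length-generators : ∀ m → length (generators m) ≡ m
length-generators zero    = refl
length-generators (suc m) = cong suc (trans (length-map (0 ∷_) (generators m)) (length-generators m))

last-generators : ∀ m → All (λ v → last v ≡ 1) (generators m)
last-generators zero    = []
last-generators (suc m) = last-replicate m 1 ∷ All.map⁺ (All.map last-∷ (last-generators m))
  where
  last-∷ : ∀ {v : Vec ℕ (suc m)} → last v ≡ 1 → last (0 ∷ v) ≡ 1
  last-∷ {_ ∷ _} eq = eq

-- An entry n stands for a gap of length suc n.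
markings : ∀ {m} → ℕ → Vec ℕ m → Vec ℕ (suc m)
markings a []       = a ∷ []
markings a (n ∷ ns) = a ∷ markings (suc n ℕ.+ a) ns

module _ {m : ℕ} where

  add-∷ : ∀ j v a y → Rulers.add (suc m) j (0 ∷ v) (a ∷ y) ≡ a ∷ Rulers.add m j v y
  add-∷ zero    v a y = refl
  add-∷ (suc j) v a y = add-∷ j v a (v ⊕ y)

  G-∷ : ∀ N v F a y → Rulers.G (suc m) N (0 ∷ v) F (a ∷ y) ≡ Rulers.G m N v (λ z → F (a ∷ z)) y
  G-∷ zero    v F a y = refl
  G-∷ (suc N) v F a y = cong (λ b → F (a ∷ v ⊕ y) + b) (G-∷ N v F a (v ⊕ y))

  -- Generators starting with 0 leave the first marking fixed, so the sum is one over vectors that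
  -- are shorter by one.
  cnt-∷ : ∀ N f vs a y → Rulers.cnt (suc m) N f (map (0 ∷_) vs) (a ∷ y) ≡ Rulers.cnt m N (λ z → f (a ∷ z)) vs y
  cnt-∷ N f []       a y = refl
  cnt-∷ N f (v ∷ vs) a y = trans (G-∷ N v (Rulers.cnt (suc m) N f (map (0 ∷_) vs)) a y)
    (Rulers.G-cong m N v y (λ j → cnt-∷ N f vs a (Rulers.add m (suc j) v y)))

  Cone-∷ : ∀ vs {a y z} → Rulers.Cone (suc m) (a ∷ y) (map (0 ∷_) vs) z →
    ∃ λ z′ → z ≡ a ∷ z′ × Rulers.Cone m y vs z′
  Cone-∷ []       refl     = _ , refl , refl
  Cone-∷ (v ∷ vs) {a} {y} {z} (j , z∈)
    with z′ , z≡ , z′∈ ← Cone-∷ vs (subst (λ x → Rulers.Cone (suc m) x (map (0 ∷_) vs) z) (add-∷ (suc j) v a y) z∈)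
    = z′ , z≡ , j , z′∈

replicate-⊕ : ∀ m a b → replicate m a ⊕ replicate m b ≡ replicate m (a ℕ.+ b)
replicate-⊕ zero    a b = refl
replicate-⊕ (suc m) a b = cong (a ℕ.+ b ∷_) (replicate-⊕ m a b)

add-replicate : ∀ m j a → Rulers.add m j (replicate (suc m) 1) (replicate (suc m) a) ≡ replicate (suc m) (j ℕ.+ a)
add-replicate m zero    a = refl
add-replicate m (suc j) a = trans (cong (Rulers.add m j (replicate (suc m) 1)) (replicate-⊕ (suc m) 1 a))
  (trans (add-replicate m j (suc a)) (cong (replicate (suc m)) (ℕ.+-suc j a)))

-- The coefficient of the first generator is the first gap and pushes all later markings together.
-- The rest of the start is again a constant vector, which is why the induction is over constant
-- starts a.
Cone-generators : ∀ m a {y} → Rulers.Cone m (replicate (suc m) a) (generators m) y → ∃ λ ns → y ≡ markings a ns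
Cone-generators zero    a refl = [] , refl
Cone-generators (suc m) a {y} (j , y∈)
  with y′ , refl , y′∈ ← Cone-∷ (generators m) (subst (λ x → Rulers.Cone (suc m) x (map (0 ∷_) (generators m)) y)
         (trans (add-∷ (suc j) (replicate (suc m) 1) a (replicate (suc m) a)) (cong (a ∷_) (add-replicate m (suc j) a))) y∈)
  with ns , refl ← Cone-generators m (suc j ℕ.+ a) y′∈
  = j ∷ ns , refl

-- Sums over lists and the enumeration of rulers by their gaps.

∑ : {A : Set} → (A → ℚ) → List A → ℚ
∑ f []       = 0ℚ
∑ f (x ∷ xs) = f x + ∑ f xs

∑-cong : ∀ {A : Set} {f g : A → ℚ} xs → (∀ x → f x ≡ g x) → ∑ f xs ≡ ∑ g xs
∑-cong []       f≗g = refl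
∑-cong (x ∷ xs) f≗g = cong₂ _+_ (f≗g x) (∑-cong xs f≗g)

∑-map : ∀ {A B : Set} (f : B → ℚ) (g : A → B) xs → ∑ f (map g xs) ≡ ∑ (f ∘ g) xs
∑-map f g []       = refl
∑-map f g (x ∷ xs) = cong (λ b → f (g x) + b) (∑-map f g xs)

∑-++ : ∀ {A : Set} (f : A → ℚ) xs ys → ∑ f (xs ++ ys) ≡ ∑ f xs + ∑ f ys
∑-++ f []       ys = sym (ℚ.+-identityˡ (∑ f ys))
∑-++ f (x ∷ xs) ys = trans (cong (λ b → f x + b) (∑-++ f xs ys)) (sym (ℚ.+-assoc (f x) (∑ f xs) (∑ f ys)))

∑-cartesianProductWith : ∀ {A B C : Set} (f : C → ℚ) (g : A → B → C) xs ys →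
  ∑ f (cartesianProductWith g xs ys) ≡ ∑ (λ x → ∑ (λ y → f (g x y)) ys) xs
∑-cartesianProductWith f g []       ys = refl
∑-cartesianProductWith f g (x ∷ xs) ys = trans (∑-++ f (map (g x) ys) (cartesianProductWith g xs ys))
  (cong₂ _+_ (∑-map f (g x) ys) (∑-cartesianProductWith f g xs ys))

∑-↭ : ∀ {A : Set} (f : A → ℚ) {xs ys} → xs ↭ ys → ∑ f xs ≡ ∑ f ys
∑-↭ f ↭.refl = refl
∑-↭ f (↭.prep x σ) = cong (λ b → f x + b) (∑-↭ f σ)
∑-↭ f (↭.swap {xs} {ys} x y σ) = trans (cong (λ b → f x + (f y + b)) (∑-↭ f σ)) (exchange (f x) (f y) (∑ f ys))
  where
  open +-*-Solver
  exchange : ∀ a b c → a + (b + c) ≡ b + (a + c)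
  exchange = solve 3 (λ a b c → a :+ (b :+ c) := b :+ (a :+ c)) refl
∑-↭ f (↭.trans σ τ) = trans (∑-↭ f σ) (∑-↭ f τ)

G-∑ : ∀ m N v F x → Rulers.G m N v F x ≡ ∑ (λ j → F (Rulers.add m (suc j) v x)) (upTo N)
G-∑ m N v F x = begin
  Rulers.G m N v F x          ≡⟨ go N x ⟩
  ∑ id (applyUpTo (term x) N) ≡⟨ cong (∑ id) (map-upTo (term x) N) ⟨
  ∑ id (map (term x) (upTo N)) ≡⟨ ∑-map id (term x) (upTo N) ⟩
  ∑ (term x) (upTo N)         ∎
  where
  term : Vec ℕ (suc m) → ℕ → ℚ
  term x j = F (Rulers.add m (suc j) v x)
  go : ∀ N x → Rulers.G m N v F x ≡ ∑ id (applyUpTo (term x) N)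
  go zero    x = refl
  go (suc N) x = cong (λ b → F (v ⊕ x) + b) (go N (v ⊕ x))

cnt-generators : ∀ m N f a →
  Rulers.cnt m N f (generators m) (replicate (suc m) a) ≡ ∑ (f ∘ markings a) (vectors (upTo N) m)
cnt-generators zero    N f a = sym (ℚ.+-identityʳ (f (a ∷ [])))
cnt-generators (suc m) N f a = begin
  Rulers.G (suc m) N v F (a ∷ as)
    ≡⟨ G-∑ (suc m) N v F (a ∷ as) ⟩
  ∑ (λ j → F (Rulers.add (suc m) (suc j) v (a ∷ as))) (upTo N)
    ≡⟨ ∑-cong (upTo N) (λ j → begin
         F (Rulers.add (suc m) (suc j) v (a ∷ as))
           ≡⟨ cong F (trans (add-∷ (suc j) (replicate (suc m) 1) a as) (cong (a ∷_) (add-replicate m (suc j) a))) ⟩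
         F (a ∷ replicate (suc m) (suc j ℕ.+ a))
           ≡⟨ cnt-∷ N f (generators m) a (replicate (suc m) (suc j ℕ.+ a)) ⟩
         Rulers.cnt m N (λ z → f (a ∷ z)) (generators m) (replicate (suc m) (suc j ℕ.+ a))
           ≡⟨ cnt-generators m N (λ z → f (a ∷ z)) (suc j ℕ.+ a) ⟩
         ∑ (λ ns → f (markings a (j ∷ ns))) (vectors (upTo N) m) ∎) ⟩
  ∑ (λ j → ∑ (λ ns → f (markings a (j ∷ ns))) (vectors (upTo N) m)) (upTo N)
    ≡⟨ ∑-cartesianProductWith (f ∘ markings a) _∷_ (upTo N) (vectors (upTo N) m) ⟨
  ∑ (f ∘ markings a) (vectors (upTo N) (suc m)) ∎
  where
  v = 0 ∷ replicate (suc m) 1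
  as = replicate (suc m) a
  F = Rulers.cnt (suc m) N f (map (0 ∷_) (generators m))

head-markings : ∀ {m} a (ns : Vec ℕ m) → head (markings a ns) ≡ a
head-markings a []      = refl
head-markings a (_ ∷ _) = refl

markings-increasing : ∀ {m} a (ns : Vec ℕ m) → Linked _<_ (markings a ns)
markings-increasing a []       = [-]
markings-increasing a (n ∷ ns) = cons (subst (a <_) (sym (head-markings (suc n ℕ.+ a) ns)) (s≤s (ℕ.m≤n+m a n)))
  (markings-increasing (suc n ℕ.+ a) ns)
  where
  cons : ∀ {m a} {x : Vec ℕ (suc m)} → a < head x → Linked _<_ x → Linked _<_ (a ∷ x)
  cons {x = _ ∷ _} a<b inc = a<b ∷ inc

markings-injective : ∀ {m} a {ns ps : Vec ℕ m} → markings a ns ≡ markings a ps → ns ≡ ps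
markings-injective a {[]}     {[]}     eq = refl
markings-injective a {n ∷ ns} {p ∷ ps} eq = cong₂ _∷_ n≡p
  (markings-injective (suc p ℕ.+ a) (subst (λ q → markings (suc q ℕ.+ a) ns ≡ markings (suc p ℕ.+ a) ps) n≡p tails))
  where
  tails = proj₂ (∷-injective eq)
  n≡p : n ≡ p
  n≡p = ℕ.suc-injective (ℕ.+-cancelʳ-≡ a (suc n) (suc p) (trans (sym (head-markings (suc n ℕ.+ a) ns))
    (trans (cong head tails) (head-markings (suc p ℕ.+ a) ps))))

head≤last : ∀ {m} {x : Vec ℕ (suc m)} → Linked _<_ x → head x ≤ last x
head≤last [-]                   = ℕ.≤-refl
head≤last {x = _ ∷ _ ∷ _} (a<b ∷ inc) = ℕ.≤-trans (ℕ.<⇒≤ a<b) (head≤last inc)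

-- The bound on the entries shows that, for rulers of length t, gap vectors with entries from
-- `upTo t` suffice.
markings-surjective : ∀ {m} {x : Vec ℕ (suc m)} → Linked _<_ x →
  ∃ λ ns → markings (head x) ns ≡ x × VecAll.All (_< last x) ns
markings-surjective {x = a ∷ []}    [-] = [] , refl , VecAll.[]
markings-surjective {x = a ∷ b ∷ x} (a<b ∷ inc) with ns , eq , bounds ← markings-surjective inc =
  b ℕ.∸ suc a ∷ ns ,
  cong (a ∷_) (trans (cong (λ c → markings c ns) gap) eq) ,
  ℕ.≤-trans (ℕ.m+n≤o⇒m≤o (suc (b ℕ.∸ suc a)) (ℕ.≤-reflexive gap)) (head≤last inc) VecAll.∷ bounds
  where
  gap : suc (b ℕ.∸ suc a) ℕ.+ a ≡ b
  gap = trans (sym (ℕ.+-suc (b ℕ.∸ suc a) a)) (ℕ.m∸n+n≡m a<b)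

∈-vectors : ∀ {A : Set} {xs : List A} {k} {v : Vec A k} → VecAll.All (_∈ xs) v → v ∈ vectors xs k
∈-vectors VecAll.[]       = here refl
∈-vectors (p VecAll.∷ ps) = ∈-cartesianProductWith⁺ _∷_ p (∈-vectors ps)

vectors-unique : ∀ {A : Set} {xs : List A} → Unique xs → ∀ k → Unique (vectors xs k)
vectors-unique u zero    = [] ∷ []
vectors-unique u (suc k) = Unique.cartesianProductWith⁺ _∷_ ∷-injective u (vectors-unique u k)

markings-↭-rulers : ∀ m t →
  filter (λ x → last x ℕ.≟ t) (map (markings 0) (vectors (upTo t) m)) ↭ rulers m t
markings-↭-rulers m t = ∼bag⇒↭ (unique∧set⇒bag
  (Unique.filter⁺ (λ x → last x ℕ.≟ t) (Unique.map⁺ (markings-injective 0) (vectors-unique (Unique.upTo⁺ t) m)))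
  (rulers-unique m t)
  (mk⇔ to from))
  where
  to : ∀ {x} → x ∈ filter (λ x → last x ℕ.≟ t) (map (markings 0) (vectors (upTo t) m)) → x ∈ rulers m t
  to x∈ with x∈map , last≡t ← ∈-filter⁻ (λ x → last x ℕ.≟ t) {xs = map (markings 0) (vectors (upTo t) m)} x∈
    with ns , _ , refl ← ∈-map⁻ (markings 0) x∈map
    = rulers-complete (head-markings 0 ns , markings-increasing 0 ns , last≡t)
  from : ∀ {x} → x ∈ rulers m t → x ∈ filter (λ x → last x ℕ.≟ t) (map (markings 0) (vectors (upTo t) m))
  from x∈ with _ , head≡0 , inc , last≡t ← ∈-filter⁻ (isRuler? m t) {xs = vectors (upTo (suc t)) (suc m)} x∈
    with ns , eq , bounds ← markings-surjective inc
    = ∈-filter⁺ (λ x → last x ℕ.≟ t)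
        (subst (_∈ map (markings 0) (vectors (upTo t) m)) (trans (cong (λ a → markings a ns) (sym head≡0)) eq)
          (∈-map⁺ (markings 0) (∈-vectors (VecAll.map (λ b → ∈-upTo⁺ (ℕ.<-≤-trans b (ℕ.≤-reflexive last≡t))) bounds))))
        last≡t

∑-level : ∀ m t (φ : Vec ℕ (suc m) → ℚ) xs →
  ∑ (λ x → Rulers.level m t x * φ x) xs ≡ ∑ φ (filter (λ x → last x ℕ.≟ t) xs)
∑-level m t φ []       = refl
∑-level m t φ (x ∷ xs) = by-cases (last x ℕ.≟ t)
  where
  at-t? = λ (x : Vec ℕ (suc m)) → last x ℕ.≟ t
  by-cases : Dec (last x ≡ t) → ∑ (λ x → Rulers.level m t x * φ x) (x ∷ xs) ≡ ∑ φ (filter at-t? (x ∷ xs))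
  by-cases (yes eq) = trans
    (cong₂ _+_ (trans (cong (_* φ x) (Rulers.level-≡ m eq)) (ℚ.*-identityˡ (φ x))) (∑-level m t φ xs))
    (cong (∑ φ) (sym (filter-accept at-t? eq)))
  by-cases (no neq) = trans
    (cong₂ _+_ (trans (cong (_* φ x) (Rulers.level-≢ m neq)) (ℚ.*-zeroˡ (φ x))) (∑-level m t φ xs))
    (trans (ℚ.+-identityˡ (∑ φ (filter at-t? xs))) (cong (∑ φ) (sym (filter-reject at-t? neq))))

weighted-generators : ∀ m (φ : Vec ℕ (suc m) → ℚ) t → RulerForms.weighted m φ (generators m) t ≡ ∑ φ (rulers m t)
weighted-generators m φ t = begin
  RulerForms.weighted m φ (generators m) t
    ≡⟨ cnt-generators m t f 0 ⟩
  ∑ (f ∘ markings 0) (vectors (upTo t) m)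
    ≡⟨ ∑-map f (markings 0) (vectors (upTo t) m) ⟨
  ∑ f (map (markings 0) (vectors (upTo t) m))
    ≡⟨ ∑-level m t φ (map (markings 0) (vectors (upTo t) m)) ⟩
  ∑ φ (filter (λ x → last x ℕ.≟ t) (map (markings 0) (vectors (upTo t) m)))
    ≡⟨ ∑-↭ φ (markings-↭-rulers m t) ⟩
  ∑ φ (rulers m t) ∎
  where
  f : Vec ℕ (suc m) → ℚ
  f x = Rulers.level m t x * φ x

-- Counting the rulers in a class determined by linear forms.

module _ {A : Set} {P : A → Set} (P? : Decidable P) where

  -- The indicator of the complement: it vanishes off the hyperplanes, as the generic case demands,
  -- and so contributes only to lower degrees.
  violates : A → ℚ
  violates x with P? x
  ... | yes _ = 0ℚ
  ... | no  _ = 1ℚ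

  violates-yes : ∀ {x} → P x → violates x ≡ 0ℚ
  violates-yes {x} px with P? x
  ... | yes _   = refl
  ... | no  ¬px = contradiction px ¬px

  violates-cong : ∀ {x y} → (P x → P y) → (P y → P x) → violates x ≡ violates y
  violates-cong {x} {y} x⇒y y⇒x with P? x | P? y
  ... | yes _  | yes _   = refl
  ... | yes px | no  ¬py = contradiction (x⇒y px) ¬py
  ... | no ¬px | yes py  = contradiction (y⇒x py) ¬px
  ... | no  _  | no  _   = refl

  length-filter-∑ : ∀ xs → κ (+ length (filter P? xs)) ≡ ∑ (λ _ → 1ℚ) xs - ∑ violates xs
  length-filter-∑ []       = refl
  length-filter-∑ (x ∷ xs) with P? x
  ... | yes _ = trans (κ-+ (+ 1) (+ length (filter P? xs)))
    (trans (cong (λ b → 1ℚ + b) (length-filter-∑ xs)) (accept (∑ (λ _ → 1ℚ) xs) (∑ violates xs)))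
    where
    open +-*-Solver
    accept : ∀ a b → 1ℚ + (a - b) ≡ (1ℚ + a) - (0ℚ + b)
    accept = solve 2 (λ a b → con 1ℚ :+ (a :- b) := (con 1ℚ :+ a) :- (con 0ℚ :+ b)) refl
  ... | no  _ = trans (length-filter-∑ xs) (reject (∑ (λ _ → 1ℚ) xs) (∑ violates xs))
    where
    open +-*-Solver
    reject : ∀ a b → a - b ≡ (1ℚ + a) - (1ℚ + b)
    reject = solve 2 (λ a b → a :- b := (con 1ℚ :+ a) :- (con 1ℚ :+ b)) refl

-- A ruler of unspecified length.
Increasing₀ : ∀ {m} → Vec ℕ (suc m) → Set
Increasing₀ x = head x ≡ 0 × Linked _<_ x

1/n!≢0 : ∀ n → _/_ (+ 1) (n !) {{n !≢0}} ≢ 0ℚ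
1/n!≢0 n eq = contradiction (trans (sym (1/d*d≡1 (n !) {{n !≢0}}))
  (trans (cong (_* κ (+ (n !))) eq) (ℚ.*-zeroˡ (κ (+ (n !)))))) λ ()

-- The count is the number of all rulers minus the violators. The former loses its term of degree d
-- with `lead * pw d t`, since its d-th difference is 1 and the d-th difference of t^d is d!; the
-- latter is handled by `QP-weighted`.
count-IsQuasipolynomial : ∀ d {P : Vec ℕ (2 ℕ.+ d) → Set} (P? : Decidable P) (Fs : List (RulerForms.Form (suc d))) →
  (∀ {y z} → Increasing₀ y → Increasing₀ z → All (RulerForms.SameZero (suc d) y z) Fs → P y → P z) →
  (∀ {y} → Increasing₀ y → All (λ F → RulerForms.Form.⟦_⟧ F y ≢ 0ℤ) Fs → P y) →
  All (λ F → Any (λ v → RulerForms.Form.⟦_⟧ F v ≢ 0ℤ) (generators (suc d))) Fs →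
  IsQuasipolynomial (λ t → length (filter P? (rulers (suc d) t))) d (_/_ (+ 1) (d !) {{d !≢0}})
count-IsQuasipolynomial d {P} P? Fs invariant holds nonzero =
  QP⇒IsQuasipolynomial (λ t → length (filter P? (rulers (suc d) t))) d lead (1/n!≢0 d)
    (QP-cong {d} {λ t → (all t + (- lead) * pw d t) + (- 1ℚ) * weighted (violates P?) gens t}
      (λ n → let t = suc n in sym (begin
        κ (+ length (filter P? (rulers (suc d) t))) - lead * pw d t
          ≡⟨ cong (_- lead * pw d t) (length-filter-∑ P? (rulers (suc d) t)) ⟩
        (∑ (λ _ → 1ℚ) (rulers (suc d) t) - ∑ (violates P?) (rulers (suc d) t)) - lead * pw d t
          ≡⟨ cong₂ (λ a b → (a - b) - lead * pw d t) (all≡ t) (sym (weighted-generators (suc d) (violates P?) t)) ⟩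
        (all t - weighted (violates P?) gens t) - lead * pw d t
          ≡⟨ regroup (all t) (weighted (violates P?) gens t) lead (pw d t) ⟩
        (all t + (- lead) * pw d t) + (- 1ℚ) * weighted (violates P?) gens t ∎))
      (QP-+ {d} {λ t → all t + (- lead) * pw d t} {λ t → (- 1ℚ) * weighted (violates P?) gens t}
        (1 , s≤s z≤n , all-minus-top)
        (QP-*ˡ {d} {weighted (violates P?) gens} (- 1ℚ) (QP-weighted {d} {violates P?} Fs gens admissible))))
  where
  open RulerForms (suc d)
  open Rulers (suc d) using (total; Δ^-total; Cone)
  gens = generators (suc d)
  o = replicate (2 ℕ.+ d) 0
  lead = _/_ (+ 1) (d !) {{d !≢0}}
  all = total gens o

  open +-*-Solver
  regroup : ∀ a b l p → (a - b) - l * p ≡ (a + (- l) * p) + (- 1ℚ) * b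
  regroup = solve 4 (λ a b l p → (a :- b) :- l :* p := (a :+ (:- l) :* p) :+ con (- 1ℚ) :* b) refl

  all≡ : ∀ t → ∑ (λ _ → 1ℚ) (rulers (suc d) t) ≡ all t
  all≡ t = trans (sym (weighted-generators (suc d) (λ _ → 1ℚ) t))
    (trans (weighted-constant {λ _ → 1ℚ} gens t (λ _ → refl)) (ℚ.*-identityʳ (all t)))

  all-minus-top : Ann 1 d (λ t → all t + (- lead) * pw d t)
  all-minus-top n = begin
    Δ^ 1 d (λ t → all t + (- lead) * pw d t) (suc n)
      ≡⟨ Δ^-+ 1 d all (λ t → (- lead) * pw d t) n ⟩
    Δ^ 1 d all (suc n) + Δ^ 1 d (λ t → (- lead) * pw d t) (suc n)
      ≡⟨ cong₂ _+_
           (subst (λ k → Δ^ 1 k all (suc n) ≡ 1ℚ)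
             (trans (length-map (0 ∷_) (generators d)) (length-generators d))
             (Δ^-total (last-replicate (suc d) 0) (last-generators (suc d)) n))
           (Δ^-*-periodic 1 d (λ _ → - lead) (pw d) (λ _ → refl) n) ⟩
    1ℚ + (- lead) * Δ^ 1 d (pw d) (suc n)
      ≡⟨ cong (λ b → 1ℚ + (- lead) * b) (trans (Δ^-pw 1 d n) (cong (λ k → κ (+ k)) (ΔPower-1 d))) ⟩
    1ℚ + (- lead) * κ (+ (d !))
      ≡⟨ cong (λ b → 1ℚ + b) (trans (sym (ℚ.neg-distribˡ-* lead (κ (+ (d !))))) (cong -_ (1/d*d≡1 (d !) {{d !≢0}}))) ⟩
    0ℚ ∎

  increasing : ∀ {y} → Cone o gens y → Increasing₀ y
  increasing y∈ with ns , refl ← Cone-generators (suc d) 0 y∈ = head-markings 0 ns , markings-increasing 0 ns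

  admissible : Admissible d (violates P?) Fs gens
  admissible = record
    { weights>0 = All.map (λ eq → ℕ.≤-reflexive (sym eq)) (last-generators (suc d))
    ; invariant = λ y∈ z∈ same → violates-cong P?
        (invariant (increasing y∈) (increasing z∈) same)
        (invariant (increasing z∈) (increasing y∈) (All.map (λ p → proj₂ p , proj₁ p) same))
    ; small     = inj₂ record
        { length≤  = ℕ.≤-reflexive (length-generators (suc d))
        ; vanishes = λ y∈ nz → violates-yes P? (holds (increasing y∈) nz)
        ; nonzero  = nonzero
        }
    }

-- The three classes of rulers

length-filter-mono : ∀ {A : Set} {P Q : A → Set} (P? : Decidable P) (Q? : Decidable Q) xs →
  (∀ {x} → x ∈ xs → P x → Q x) → length (filter P? xs) ≤ length (filter Q? xs)
length-filter-mono P? Q? []       P⇒Q = z≤n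
length-filter-mono P? Q? (x ∷ xs) P⇒Q with P? x | Q? x
... | yes _  | yes _  = s≤s (length-filter-mono P? Q? xs (λ x∈ → P⇒Q (there x∈)))
... | yes px | no ¬qx = contradiction (P⇒Q (here refl) px) ¬qx
... | no  _  | yes _  = ℕ.m≤n⇒m≤1+n (length-filter-mono P? Q? xs (λ x∈ → P⇒Q (there x∈)))
... | no  _  | no  _  = length-filter-mono P? Q? xs (λ x∈ → P⇒Q (there x∈))

length-filter≤1 : ∀ {A : Set} {P : A → Set} (P? : Decidable P) {xs} → Unique xs →
  (∀ {x y} → x ∈ xs → y ∈ xs → P x → P y → x ≡ y) → length (filter P? xs) ≤ 1
length-filter≤1 {A} {P} P? {xs} unique P-prop =
  go (filter P? xs) (Unique.filter⁺ P? unique) (∈-filter⁻ P?)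
  where
  go : ∀ ys → Unique ys → (∀ {y} → y ∈ ys → y ∈ xs × P y) → length ys ≤ 1
  go []           _               _   = z≤n
  go (_ ∷ [])     _               _   = s≤s z≤n
  go (y ∷ z ∷ zs) ((y≢z ∷ _) ∷ _) ∈⇒P
    with y∈ , py ← ∈⇒P (here refl) | z∈ , pz ← ∈⇒P (there (here refl)) =
    contradiction (P-prop y∈ z∈ py pz) y≢z

-- If n is represented by r under `val′`, then every representation of n under `val′` represents
-- `val r` under `val`.
AtMost-transfer : ∀ g {R : Set} {rs : List R} {val val′ : R → ℕ} →
  (∀ {r} → r ∈ rs → 0 < val′ r → 0 < val r) →
  (∀ {r s} → r ∈ rs → s ∈ rs → val′ r ≡ val′ s → val r ≡ val s) →
  AtMost g rs val → AtMost g rs val′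
AtMost-transfer g {R} {rs} {val} {val′} pos same atMost n n>0 with filter (λ r → val′ r ℕ.≟ n) rs in eq
... | []    = z≤n
... | r ∷ _ with r∈rs , refl ← ∈-filter⁻ (λ r → val′ r ℕ.≟ n) {xs = rs} (subst (r ∈_) (sym eq) (here refl)) =
  subst (λ l → length l ≤ g) eq (ℕ.≤-trans
    (length-filter-mono (λ s → val′ s ℕ.≟ val′ r) (λ s → val s ℕ.≟ val r) rs (λ s∈rs → same s∈rs r∈rs))
    (atMost (val r) (pos r∈rs n>0)))

-- The common frame of the three classes. The forms give the values on increasing vectors starting
-- at 0, where truncated subtraction is exact; `val>0` is there because `AtMost` tests only positive
-- n.
module _ {d : ℕ} {R : Set} (_≟R_ : DecidableEquality R) (rs : List R) (unique : Unique rs)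
  (form : R → RulerForms.Form (suc d)) (val : Vec ℕ (2 ℕ.+ d) → R → ℕ)
  (val≡ : ∀ {x r} → Increasing₀ x → r ∈ rs → RulerForms.Form.⟦_⟧ (form r) x ≡ + val x r)
  (val>0 : ∀ {x y r} → Increasing₀ x → Increasing₀ y → r ∈ rs → 0 < val x r → 0 < val y r)
  (separated : ∀ {r s} → r ∈ rs → s ∈ rs →
    All (λ v → RulerForms.Form.⟦_⟧ (form r) v ≡ RulerForms.Form.⟦_⟧ (form s) v) (generators (suc d)) → r ≡ s)
  where

  open RulerForms (suc d) using (Form; SameZero)
  open Form

  difference : R × R → Form
  difference (r , s) = record
    { ⟦_⟧  = λ x → ⟦ form r ⟧ x ℤ.- ⟦ form s ⟧ x
    ; ⟦⟧-⊕ = λ x y → trans (cong₂ ℤ._-_ (⟦⟧-⊕ (form r) x y) (⟦⟧-⊕ (form s) x y))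
        (interchange (⟦ form r ⟧ x) (⟦ form r ⟧ y) (⟦ form s ⟧ x) (⟦ form s ⟧ y))
    ; ⟦⟧-o = cong₂ ℤ._-_ (⟦⟧-o (form r)) (⟦⟧-o (form s))
    }
    where
    open ℤ.+-*-Solver using (solve; _:=_; _:+_; _:-_)
    interchange : ∀ a b c d → (a ℤ.+ b) ℤ.- (c ℤ.+ d) ≡ (a ℤ.- c) ℤ.+ (b ℤ.- d)
    interchange = solve 4 (λ a b c d → (a :+ b) :- (c :+ d) := (a :- c) :+ (b :- d)) refl

  distinct? : Decidable (λ (p : R × R) → proj₁ p ≢ proj₂ p)
  distinct? (r , s) = ¬? (r ≟R s)

  -- A pair with equal components would give the zero form, whereas every form has to be non-zero on
  -- some generator.
  distinctPairs : List (R × R)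
  distinctPairs = filter distinct? (cartesianProduct rs rs)

  differences : List Form
  differences = map difference distinctPairs

  ∈-differences : ∀ {r s} → r ∈ rs → s ∈ rs → r ≢ s → difference (r , s) ∈ differences
  ∈-differences r∈ s∈ r≢s = ∈-map⁺ difference (∈-filter⁺ distinct? (∈-cartesianProduct⁺ r∈ s∈) r≢s)

  difference≡0⇒val≡ : ∀ {x r s} → Increasing₀ x → r ∈ rs → s ∈ rs →
    ⟦ difference (r , s) ⟧ x ≡ 0ℤ → val x r ≡ val x s
  difference≡0⇒val≡ {x} {r} {s} inc r∈ s∈ eq = ℤ.+-injective
    (trans (sym (val≡ inc r∈)) (trans (ℤ.i-j≡0⇒i≡j (⟦ form r ⟧ x) (⟦ form s ⟧ x) eq) (val≡ inc s∈)))

  val≡⇒difference≡0 : ∀ {x r s} → Increasing₀ x → r ∈ rs → s ∈ rs →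
    val x r ≡ val x s → ⟦ difference (r , s) ⟧ x ≡ 0ℤ
  val≡⇒difference≡0 {x} {r} {s} inc r∈ s∈ eq =
    ℤ.i≡j⇒i-j≡0 {⟦ form r ⟧ x} {⟦ form s ⟧ x} (trans (val≡ inc r∈) (trans (cong +_ eq) (sym (val≡ inc s∈))))

  AtMost-invariant : ∀ g {y z} → Increasing₀ y → Increasing₀ z → All (SameZero y z) differences →
    AtMost g rs (val y) → AtMost g rs (val z)
  AtMost-invariant g {y} {z} incy incz same = AtMost-transfer g
    (λ r∈ → val>0 incz incy r∈) same-value
    where
    same-value : ∀ {r s} → r ∈ rs → s ∈ rs → val z r ≡ val z s → val y r ≡ val y s
    same-value {r} {s} r∈ s∈ eq with r ≟R s
    ... | yes refl = refl
    ... | no  r≢s  = difference≡0⇒val≡ incy r∈ s∈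
      (proj₂ (All.lookup same (∈-differences r∈ s∈ r≢s)) (val≡⇒difference≡0 incz r∈ s∈ eq))

  -- Off all the hyperplanes distinct candidates have distinct values, so every n is represented at
  -- most once.
  AtMost-generic : ∀ {g y} → 1 ≤ g → Increasing₀ y → All (λ F → ⟦ F ⟧ y ≢ 0ℤ) differences → AtMost g rs (val y)
  AtMost-generic {g} {y} g≥1 inc ≢0 n _ = ℕ.≤-trans
    (length-filter≤1 (λ r → val y r ℕ.≟ n) unique (λ r∈ s∈ r≡ s≡ → injective r∈ s∈ (trans r≡ (sym s≡)))) g≥1
    where
    injective : ∀ {r s} → r ∈ rs → s ∈ rs → val y r ≡ val y s → r ≡ s
    injective {r} {s} r∈ s∈ eq with r ≟R s
    ... | yes r≡s = r≡s
    ... | no  r≢s = contradiction (val≡⇒difference≡0 inc r∈ s∈ eq) (All.lookup ≢0 (∈-differences r∈ s∈ r≢s))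

  differences-nonzero : All (λ F → Any (λ v → ⟦ F ⟧ v ≢ 0ℤ) (generators (suc d))) differences
  differences-nonzero = All.tabulate nonzero
    where
    nonzero : ∀ {F} → F ∈ differences → Any (λ v → ⟦ F ⟧ v ≢ 0ℤ) (generators (suc d))
    nonzero F∈ with (r , s) , p∈ , refl ← ∈-map⁻ difference F∈
      with p∈rs² , r≢s ← ∈-filter⁻ distinct? {xs = cartesianProduct rs rs} p∈
      with r∈ , s∈ ← ∈-cartesianProduct⁻ rs rs p∈rs²
      with Any.any? (λ v → ¬? (⟦ difference (r , s) ⟧ v ℤ.≟ 0ℤ)) (generators (suc d))
    ... | yes any  = any
    ... | no  none = contradiction (separated r∈ s∈ (All.map (λ {v} ¬≢0 →
          ℤ.i-j≡0⇒i≡j (⟦ form r ⟧ v) (⟦ form s ⟧ v) (decidable-stable (⟦ difference (r , s) ⟧ v ℤ.≟ 0ℤ) ¬≢0))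
          (All.¬Any⇒All¬ (generators (suc d)) none))) r≢s

  AtMost-IsQuasipolynomial : ∀ {g} → 1 ≤ g → (P? : Decidable (λ x → AtMost g rs (val x))) →
    IsQuasipolynomial (λ t → length (filter P? (rulers (suc d) t))) d (_/_ (+ 1) (d !) {{d !≢0}})
  AtMost-IsQuasipolynomial {g} g≥1 P? = count-IsQuasipolynomial d P? differences
    (AtMost-invariant g) (AtMost-generic g≥1) differences-nonzero

-- Separation: distinct representations differ on some generator.

threshold : ℕ → ℕ → ℕ
threshold zero    j       = 1
threshold (suc t) zero    = 0
threshold (suc t) (suc j) = threshold t j

threshold-≤ : ∀ {t j} → t ≤ j → threshold t j ≡ 1
threshold-≤ z≤n       = refl
threshold-≤ (s≤s t≤j) = threshold-≤ t≤j

threshold-> : ∀ {t j} → j < t → threshold t j ≡ 0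
threshold-> {suc t} {zero}  _         = refl
threshold-> {suc t} {suc j} (s≤s j<t) = threshold-> j<t

-- Generator number t, counted from 0, has its first 1 in position t + 1, whence the successor.
generators-threshold : ∀ {m} (t : Fin m) →
  ∃ λ v → v ∈ generators m × (∀ j → lookup v j ≡ threshold (suc (toℕ t)) (toℕ j))
generators-threshold {suc m} zero = _ , here refl , λ where
  zero    → refl
  (suc j) → lookup-replicate j 1
generators-threshold {suc m} (suc t) with v , v∈ , v≡ ← generators-threshold t =
  0 ∷ v , there (∈-map⁺ (0 ∷_) v∈) , λ where
    zero    → refl
    (suc j) → v≡ j

lookup-< : ∀ {m} {x : Vec ℕ (suc m)} {i j} → Increasing₀ x → i Fin.< j → lookup x i < lookup x j
lookup-< (_ , inc) i<j = Linked.lookup⁺ ℕ.<-trans inc i<j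

-- Position 0 carries the marking 0 and every other position a positive one, so positivity depends
-- on the index alone.
lookup>0 : ∀ {m} {x y : Vec ℕ (suc m)} (i : Fin (suc m)) → Increasing₀ x → Increasing₀ y →
  0 < lookup x i → 0 < lookup y i
lookup>0 {x = _ ∷ _} zero    (refl , _) _ ()
lookup>0             (suc i) _ incy     _ = ℕ.≤-<-trans z≤n (lookup-< incy (s≤s (z≤n {toℕ i})))

thresholdCount : ∀ {h m} → ℕ → Vec (Fin m) h → ℕ
thresholdCount t r = Vec.sum (Vec.map (threshold t ∘ toℕ) r)

thresholdCount-all : ∀ {h m t} {r : Vec (Fin m) h} → VecAll.All (λ a → t ≤ toℕ a) r → thresholdCount t r ≡ h
thresholdCount-all VecAll.[]            = refl
thresholdCount-all (t≤a VecAll.∷ t≤as) = cong₂ ℕ._+_ (threshold-≤ t≤a) (thresholdCount-all t≤as)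

threshold≤1 : ∀ t j → threshold t j ≤ 1
threshold≤1 zero    j       = ℕ.≤-refl
threshold≤1 (suc t) zero    = z≤n
threshold≤1 (suc t) (suc j) = threshold≤1 t j

thresholdCount≤ : ∀ {h m} t (r : Vec (Fin m) h) → thresholdCount t r ≤ h
thresholdCount≤ t []      = z≤n
thresholdCount≤ t (a ∷ r) = ℕ.+-mono-≤ (threshold≤1 t (toℕ a)) (thresholdCount≤ t r)

-- All h + 1 entries of the sorted `a ∷ r` are at least a. If b < a, then at most the h entries of s
-- could reach a on the other side.
head≤ : ∀ {h m a b} (r s : Vec (Fin m) h) → Linked Fin._≤_ (a ∷ r) →
  thresholdCount (toℕ a) (a ∷ r) ≡ thresholdCount (toℕ a) (b ∷ s) → a Fin.≤ b
head≤ {h} {a = a} {b} r s sorted eq with a Fin.≤? b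
... | yes a≤b = a≤b
... | no  a≰b = contradiction
  (subst (_≤ h) (begin
    thresholdCount (toℕ a) s       ≡⟨ cong (ℕ._+ thresholdCount (toℕ a) s) (threshold-> (ℕ.≰⇒> a≰b)) ⟨
    thresholdCount (toℕ a) (b ∷ s) ≡⟨ eq ⟨
    thresholdCount (toℕ a) (a ∷ r) ≡⟨ thresholdCount-all (Linked.Linked⇒All Fin.≤-trans (Fin.≤-refl {x = a}) sorted) ⟩
    suc h                          ∎) (thresholdCount≤ (toℕ a) s))
  ℕ.1+n≰n

-- The counts determine the smallest entry; its contribution is cancelled and the tails are
-- compared.
sorted-≡ : ∀ {h m} {r s : Vec (Fin m) h} → Linked Fin._≤_ r → Linked Fin._≤_ s →
  (∀ (a : Fin m) → thresholdCount (toℕ a) r ≡ thresholdCount (toℕ a) s) → r ≡ s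
sorted-≡ {r = []}    {[]}    _ _ _ = refl
sorted-≡ {r = a ∷ r} {b ∷ s} sr ss eq
  with refl ← Fin.≤-antisym (head≤ r s sr (eq a)) (head≤ s r ss (sym (eq b))) =
  cong (a ∷_) (sorted-≡ (Linked.tail sr) (Linked.tail ss)
    (λ c → ℕ.+-cancelˡ-≡ (threshold (toℕ c) (toℕ a)) _ _ (eq c)))

sequenceSum-⊕ : ∀ {h m} (x y : Vec ℕ (suc m)) (r : Vec (Fin (suc m)) h) →
  sequenceSum (x ⊕ y) r ≡ sequenceSum x r ℕ.+ sequenceSum y r
sequenceSum-⊕ x y []      = refl
sequenceSum-⊕ x y (a ∷ r) = trans
  (cong₂ ℕ._+_ (lookup-zipWith ℕ._+_ a x y) (sequenceSum-⊕ x y r))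
  (interchange (lookup x a) (lookup y a) (sequenceSum x r) (sequenceSum y r))
  where
  open ℕ.+-*-Solver using (solve; _:=_; _:+_)
  interchange : ∀ a b c d → (a ℕ.+ b) ℕ.+ (c ℕ.+ d) ≡ (a ℕ.+ c) ℕ.+ (b ℕ.+ d)
  interchange = solve 4 (λ a b c d → (a :+ b) :+ (c :+ d) := (a :+ c) :+ (b :+ d)) refl

sequenceSum-0 : ∀ {h m} (r : Vec (Fin (suc m)) h) → sequenceSum (replicate (suc m) 0) r ≡ 0
sequenceSum-0 []      = refl
sequenceSum-0 (a ∷ r) = cong₂ ℕ._+_ (lookup-replicate a 0) (sequenceSum-0 r)

sequenceSum-threshold : ∀ {h m} t (v : Vec ℕ (suc m)) → (∀ j → lookup v j ≡ threshold t (toℕ j)) →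
  (r : Vec (Fin (suc m)) h) → sequenceSum v r ≡ thresholdCount t r
sequenceSum-threshold t v v≡ []      = refl
sequenceSum-threshold t v v≡ (a ∷ r) = cong₂ ℕ._+_ (v≡ a) (sequenceSum-threshold t v v≡ r)

sequenceSum>0 : ∀ {h m} {x y : Vec ℕ (suc m)} (r : Vec (Fin (suc m)) h) → Increasing₀ x → Increasing₀ y →
  0 < sequenceSum x r → 0 < sequenceSum y r
sequenceSum>0 {x = x} {y} (a ∷ r) incx incy Σ>0 with lookup x a in eq
... | suc _ = ℕ.<-≤-trans (lookup>0 a incx incy (subst (0 <_) (sym eq) (s≤s z≤n))) (ℕ.m≤m+n (lookup y a) (sequenceSum y r))
... | zero  = ℕ.<-≤-trans (sequenceSum>0 r incx incy Σ>0) (ℕ.m≤n+m (sequenceSum y r) (lookup y a))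

sequenceForm : ∀ {h m} → Vec (Fin (suc m)) h → RulerForms.Form m
sequenceForm {m = m} r = record
  { ⟦_⟧  = λ x → + sequenceSum x r
  ; ⟦⟧-⊕ = λ x y → trans (cong +_ (sequenceSum-⊕ x y r)) (ℤ.pos-+ (sequenceSum x r) (sequenceSum y r))
  ; ⟦⟧-o = cong +_ (sequenceSum-0 r)
  }

sequences-separated : ∀ {h m} {r s : Vec (Fin (suc m)) h} → Linked Fin._≤_ r → Linked Fin._≤_ s →
  All (λ v → + sequenceSum v r ≡ + sequenceSum v s) (generators m) → r ≡ s
sequences-separated {h} {m} {r} {s} sr ss agree = sorted-≡ sr ss same
  where
  same : ∀ (a : Fin (suc m)) → thresholdCount (toℕ a) r ≡ thresholdCount (toℕ a) s
  -- No generator has threshold 0, but every entry reaches 0, so both counts equal h.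
  same zero    = trans (thresholdCount-all (VecAll.universal (λ _ → z≤n) r))
                       (sym (thresholdCount-all (VecAll.universal (λ _ → z≤n) s)))
  same (suc t) with v , v∈ , v≡ ← generators-threshold t =
    trans (sym (sequenceSum-threshold (suc (toℕ t)) v v≡ r)) (trans (ℤ.+-injective (All.lookup agree v∈)) (sequenceSum-threshold (suc (toℕ t)) v v≡ s))

differenceForm : ∀ {m} → Fin (suc m) × Fin (suc m) → RulerForms.Form m
differenceForm {m} (i , j) = record
  { ⟦_⟧  = λ x → + lookup x j ℤ.- + lookup x i
  ; ⟦⟧-⊕ = λ x y → trans
      (cong₂ (λ a b → + a ℤ.- + b) (lookup-zipWith ℕ._+_ j x y) (lookup-zipWith ℕ._+_ i x y))
      (trans (cong₂ ℤ._-_ (ℤ.pos-+ (lookup x j) (lookup y j)) (ℤ.pos-+ (lookup x i) (lookup y i)))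
        (interchange (+ lookup x j) (+ lookup y j) (+ lookup x i) (+ lookup y i)))
  ; ⟦⟧-o = cong₂ (λ a b → + a ℤ.- + b) (lookup-replicate j 0) (lookup-replicate i 0)
  }
  where
  open ℤ.+-*-Solver using (solve; _:=_; _:+_; _:-_)
  interchange : ∀ a b c d → (a ℤ.+ b) ℤ.- (c ℤ.+ d) ≡ (a ℤ.- c) ℤ.+ (b ℤ.- d)
  interchange = solve 4 (λ a b c d → (a :+ b) :- (c :+ d) := (a :- c) :+ (b :- d)) refl

-- On the generator whose first 1 is in position s the form is the indicator of i < s ≤ j. The
-- choice s = j yields j ≤ l, and s = i + 1 yields k ≤ i.
differences-nested : ∀ {m} {i j k l : Fin (suc m)} → i Fin.< j → k Fin.< l →
  All (λ v → + lookup v j ℤ.- + lookup v i ≡ + lookup v l ℤ.- + lookup v k) (generators m) →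
  j Fin.≤ l × k Fin.≤ i
differences-nested {m} {i} {j} {k} {l} i<j k<l agree = upper , lower
  where
  at : ∀ t → t < m →
    + threshold (suc t) (toℕ j) ℤ.- + threshold (suc t) (toℕ i) ≡
    + threshold (suc t) (toℕ l) ℤ.- + threshold (suc t) (toℕ k)
  at t t<m with v , v∈ , v≡ ← generators-threshold (Fin.fromℕ< t<m) rewrite Fin.toℕ-fromℕ< t<m =
    trans (cong₂ (λ a b → + a ℤ.- + b) (sym (v≡ j)) (sym (v≡ i)))
      (trans (All.lookup agree v∈) (cong₂ (λ a b → + a ℤ.- + b) (v≡ l) (v≡ k)))

  at-value : ∀ t → t < m → ∀ {a b c d} →
    threshold (suc t) (toℕ j) ≡ a → threshold (suc t) (toℕ i) ≡ b →
    threshold (suc t) (toℕ l) ≡ c → threshold (suc t) (toℕ k) ≡ d → + a ℤ.- + b ≡ + c ℤ.- + d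
  at-value t t<m refl refl refl refl = at t t<m

  upper : j Fin.≤ l
  upper with j Fin.≤? l
  ... | yes j≤l = j≤l
  -- The generator with first 1 in position j has number j - 1, so j has to be exhibited as a
  -- successor.
  ... | no  j≰l = contradiction refl (absurd (toℕ j))
    where
    absurd : ∀ n → toℕ j ≢ n
    absurd zero    j≡0 = ℕ.n≮0 (subst (toℕ i <_) j≡0 i<j)
    absurd (suc t) j≡ = contradiction
      (at-value t (subst (_≤ m) j≡ (ℕ.≤-pred (Fin.toℕ<n j)))
        (threshold-≤ (ℕ.≤-reflexive (sym j≡)))
        (threshold-> (subst (toℕ i <_) j≡ i<j))
        (threshold-> (subst (toℕ l <_) j≡ (ℕ.≰⇒> j≰l)))
        (threshold-> (subst (toℕ k <_) j≡ (ℕ.<-trans k<l (ℕ.≰⇒> j≰l)))))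
      λ ()

  lower : k Fin.≤ i
  lower with k Fin.≤? i
  ... | yes k≤i = k≤i
  ... | no  k≰i = contradiction
    (at-value (toℕ i) (ℕ.<-≤-trans i<j (ℕ.≤-pred (Fin.toℕ<n j)))
      (threshold-≤ i<j) (threshold-> (ℕ.n<1+n (toℕ i)))
      (threshold-≤ (ℕ.<-trans (ℕ.≰⇒> k≰i) k<l)) (threshold-≤ (ℕ.≰⇒> k≰i)))
    λ ()

differences-separated : ∀ {m} {p q : Fin (suc m) × Fin (suc m)} → uncurry Fin._<_ p → uncurry Fin._<_ q →
  All (λ v → RulerForms.Form.⟦_⟧ (differenceForm p) v ≡ RulerForms.Form.⟦_⟧ (differenceForm q) v) (generators m) → p ≡ q
differences-separated i<j k<l agree
  with j≤l , k≤i ← differences-nested i<j k<l agree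
     | l≤j , i≤k ← differences-nested k<l i<j (All.map sym agree) =
  cong₂ _,_ (Fin.≤-antisym i≤k k≤i) (Fin.≤-antisym j≤l l≤j)

-- Application to sums of h markings and to differences and sums of two markings.

_≟²_ : ∀ {n} → DecidableEquality (Fin n × Fin n)
_≟²_ = ×-≡-dec Fin._≟_ Fin._≟_

bₕ-IsQuasipolynomial : ∀ h d → IsQuasipolynomial (bₕ h (suc d)) d (_/_ (+ 1) (d !) {{d !≢0}})
bₕ-IsQuasipolynomial h d = AtMost-IsQuasipolynomial (Vec-≡-dec Fin._≟_) rs
  (Unique.filter⁺ (linked? Fin._≤?_) (vectors-unique (Unique.allFin⁺ (2 ℕ.+ d)) h))
  sequenceForm sequenceSum (λ _ _ → refl) (λ {_} {_} {r} incx incy _ → sequenceSum>0 r incx incy)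
  (λ r∈ s∈ → sequences-separated (sorted r∈) (sorted s∈))
  ℕ.≤-refl (isB? h)
  where
  rs = sequences≤ h (suc d)
  sorted : ∀ {r} → r ∈ rs → Linked Fin._≤_ r
  sorted r∈ = proj₂ (∈-filter⁻ (linked? Fin._≤?_) {xs = vectors (allFin (2 ℕ.+ d)) h} r∈)

b⁻-IsQuasipolynomial : ∀ g d → 1 ≤ g → IsQuasipolynomial (b⁻[ g ] (suc d)) d (_/_ (+ 1) (d !) {{d !≢0}})
b⁻-IsQuasipolynomial g d g≥1 = AtMost-IsQuasipolynomial _≟²_ rs
  (Unique.filter⁺ (uncurry Fin._<?_) (Unique.cartesianProduct⁺ (Unique.allFin⁺ n) (Unique.allFin⁺ n)))
  differenceForm pairDiff
  (λ {x} {(i , j)} inc r∈ → trans (ℤ.m-n≡m⊖n (lookup x j) (lookup x i)) (ℤ.⊖-≥ (ℕ.<⇒≤ (lookup-< inc (ordered r∈)))))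
  (λ _ incy r∈ _ → ℕ.m<n⇒0<n∸m (lookup-< incy (ordered r∈)))
  (λ r∈ s∈ → differences-separated (ordered r∈) (ordered s∈))
  g≥1 isB₂⁻[ g ]?
  where
  n = 2 ℕ.+ d
  rs = pairs< (suc d)
  ordered : ∀ {r} → r ∈ rs → uncurry Fin._<_ r
  ordered r∈ = proj₂ (∈-filter⁻ (uncurry Fin._<?_) {xs = cartesianProduct (allFin n) (allFin n)} r∈)

b-IsQuasipolynomial : ∀ g d → 1 ≤ g → IsQuasipolynomial (b[ g ] (suc d)) d (_/_ (+ 1) (d !) {{d !≢0}})
b-IsQuasipolynomial g d g≥1 = AtMost-IsQuasipolynomial _≟²_ rs
  (Unique.filter⁺ (uncurry Fin._≤?_) (Unique.cartesianProduct⁺ (Unique.allFin⁺ n) (Unique.allFin⁺ n)))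
  -- A pair i ≤ j is read as a sorted sequence of length two, so that the separation of sequences
  -- applies.
  (λ r → sequenceForm (toSequence r)) pairSum
  (λ {x} {r} _ _ → cong +_ (sequenceSum-pair x r))
  (λ {x} {y} {r} incx incy _ Σ>0 → subst (0 <_) (sequenceSum-pair y r)
    (sequenceSum>0 (toSequence r) incx incy (subst (0 <_) (sym (sequenceSum-pair x r)) Σ>0)))
  (λ r∈ s∈ agree → toSequence-injective (sequences-separated (ordered r∈ ∷ [-]) (ordered s∈ ∷ [-]) agree))
  g≥1 isB₂[ g ]?
  where
  n = 2 ℕ.+ d
  rs = pairs≤ (suc d)
  toSequence : Fin n × Fin n → Vec (Fin n) 2
  toSequence (i , j) = i ∷ j ∷ []
  toSequence-injective : ∀ {r s} → toSequence r ≡ toSequence s → r ≡ s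
  toSequence-injective refl = refl
  sequenceSum-pair : ∀ x r → sequenceSum x (toSequence r) ≡ pairSum x r
  sequenceSum-pair x (i , j) = cong (lookup x i ℕ.+_) (ℕ.+-identityʳ (lookup x j))
  ordered : ∀ {r} → r ∈ rs → uncurry Fin._≤_ r
  ordered r∈ = proj₂ (∈-filter⁻ (uncurry Fin._≤?_) {xs = cartesianProduct (allFin n) (allFin n)} r∈)

theorem2p3 : (m h g : ℕ) → 1 ≤ m → 2 ≤ h → 2 ≤ g →
    let lead : ℚ
        lead = _/_ (+ 1) ((m ∸ 1) !) {{(m ∸ 1) !≢0}}
    in IsQuasipolynomial (b[ g ] m) (m ∸ 1) lead
     × IsQuasipolynomial (b⁻[ g ] m) (m ∸ 1) lead
     × IsQuasipolynomial (bₕ h m) (m ∸ 1) lead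
theorem2p3 (suc d) h g _ _ g≥2 =
  b-IsQuasipolynomial g d (ℕ.<⇒≤ g≥2) , b⁻-IsQuasipolynomial g d (ℕ.<⇒≤ g≥2) , bₕ-IsQuasipolynomial h d
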